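{- Let $L$ be a countable first-order language and let $\mathbf{K}$ be a Borel class of $L$-structures with domain $\omega$ such that $|\mathrm{Aut}(A)|\leq\aleph_0$ for every $A\in\mathbf{K}$. Then the isomorphism relation $\{(A,B)\in\mathbf{K}\times\mathbf{K} : A\cong B\}$ is a Borel subset of $\mathbf{K}\times\mathbf{K}$, and so in particular $\mathbf{K}$ is not Borel complete.
   Context: A Borel class of $L$-structures with domain $\omega$ is a Borel subset of the standard Borel space of all $L$-structures with domain $\omega$. Let $\mathbf{K}^{\aleph_0}_{\mathrm{gf}}$ be the standard Borel space of graphs with domain $\omega$. A Borel class $\mathbf{K}$ of $L$-structures with domain $\omega$ is Borel complete if there exists a Borel map $f:\mathbf{K}^{\aleph_0}_{\mathrm{gf}}\to\mathbf{K}$ such that for all $A,B\in\mathbf{K}^{\aleph_0}_{\mathrm{gf}}$ we have $A\cong B$ if and only if $f(A)\cong f(B)$. -}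

module Defs where

open import Axiom.ExcludedMiddle using (ExcludedMiddle)
open import Data.Bool.Base using (Bool; true; false)
open import Data.Empty using (⊥)
open import Data.Nat.Base using (ℕ)
open import Data.Product.Base using (Σ; ∃; _×_; _,_; proj₁; proj₂)
open import Data.Unit.Base using (⊤; tt)
open import Data.Vec.Base using (Vec; []; _∷_; map)
open import Function.Bundles using (Injection; Inverse; _↣_; _↔_; _⇔_)
open import Level using (0ℓ; Setω)
open import Relation.Binary.Bundles using (Setoid)
open import Relation.Binary.PropositionalEquality
  using (_≡_; refl; sym; trans; setoid)
open import Relation.Unary using (Pred; U; ∁; ⋃; _≐_; _⊢_; _⟨×⟩_)

-- Classical logic, taken as a hypothesis. `Dec` is not truncated, so this also
-- provides choice: from ¬ ¬ A one obtains an element of A.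

ClassicalLogic : Setω
ClassicalLogic = ∀ ℓ → ExcludedMiddle ℓ

-- Subsets are predicates, and equality of subsets is _≐_; hence `resp`.

record MeasurableSpace : Set₂ where
  field
    Carrier    : Set
    Measurable : Pred Carrier 0ℓ → Set₁
    resp       : ∀ {S T} → S ≐ T → Measurable S → Measurable T
    univ       : Measurable U
    compl      : ∀ {S} → Measurable S → Measurable (∁ S)
    union      : ∀ {S : ℕ → Pred Carrier 0ℓ} →
                 (∀ n → Measurable (S n)) → Measurable (⋃ ℕ S)

open MeasurableSpace public using (Carrier; Measurable)

data Generated {X : Set} (G : Pred X 0ℓ → Set₁) : Pred X 0ℓ → Set₁ where
  gen   : ∀ {S} → G S → Generated G S
  resp  : ∀ {S T} → S ≐ T → Generated G S → Generated G T
  univ  : Generated G U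
  compl : ∀ {S} → Generated G S → Generated G (∁ S)
  union : ∀ {S : ℕ → Pred X 0ℓ} →
          (∀ n → Generated G (S n)) → Generated G (⋃ ℕ S)

generate : (X : Set) → (Pred X 0ℓ → Set₁) → MeasurableSpace
generate X G = record
  { Carrier    = X
  ; Measurable = Generated G
  ; resp       = resp
  ; univ       = univ
  ; compl      = compl
  ; union      = union
  }

subspace : (X : MeasurableSpace) → Pred (Carrier X) 0ℓ → MeasurableSpace
subspace X K = record
  { Carrier    = Σ (Carrier X) K
  ; Measurable = λ S → ∃ λ T → Measurable X T × S ≐ proj₁ ⊢ T
  ; resp       = λ (S⊆S′ , S′⊆S) (T , mT , S⊆T , T⊆S) →
                   T , mT , (λ x → S⊆T (S′⊆S x)) , (λ x → S⊆S′ (T⊆S x))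
  ; univ       = U , X.univ , (λ x → x) , (λ x → x)
  ; compl      = λ (T , mT , S⊆T , T⊆S) →
                   ∁ T , X.compl mT , (λ ¬s t → ¬s (T⊆S t)) , (λ ¬t s → ¬t (S⊆T s))
  ; union      = λ m →
                   ⋃ ℕ (λ n → proj₁ (m n)) , X.union (λ n → proj₁ (proj₂ (m n))) ,
                   (λ (n , s) → n , proj₁ (proj₂ (proj₂ (m n))) s) ,
                   (λ (n , t) → n , proj₂ (proj₂ (proj₂ (m n))) t)
  }
  where module X = MeasurableSpace X

data Rectangle (X Y : MeasurableSpace) : Pred (Carrier X × Carrier Y) 0ℓ → Set₁ where
  rectangle : ∀ {S T} → Measurable X S → Measurable Y T → Rectangle X Y (S ⟨×⟩ T)

infixr 2 _⊗_

_⊗_ : MeasurableSpace → MeasurableSpace → MeasurableSpace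
X ⊗ Y = generate (Carrier X × Carrier Y) (Rectangle X Y)

MeasurableMap : (X Y : MeasurableSpace) → (Carrier X → Carrier Y) → Set₁
MeasurableMap X Y f = ∀ {S} → Measurable Y S → Measurable X (f ⊢ S)

record Language : Set₁ where
  field
    Rel      : Set
    relArity : Rel → ℕ
    Fun      : Set
    funArity : Fun → ℕ

open Language public

CountableLanguage : Language → Set
CountableLanguage L = (Rel L ↣ ℕ) × (Fun L ↣ ℕ)

-- Constants are the function symbols of arity 0. Relations are points of
-- 2^(ω^n), hence the values in Bool.

record Structure (L : Language) : Set where
  field
    rel : (R : Rel L) → Vec ℕ (relArity L R) → Bool
    fun : (F : Fun L) → Vec ℕ (funArity L F) → ℕ

open Structure public

-- For countable L, the sets below are a countable clopen subbasis of the
-- product topology on ∏ 2^(ω^n) × ∏ ω^(ω^n), so they generate its Borel sets.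

data Basic (L : Language) : Pred (Structure L) 0ℓ → Set₁ where
  rel-holds : ∀ R v   → Basic L (λ A → rel A R v ≡ true)
  fun-value : ∀ F v m → Basic L (λ A → fun A F v ≡ m)

StructureSpace : Language → MeasurableSpace
StructureSpace L = generate (Structure L) (Basic L)

IsBorelClass : (L : Language) → Pred (Structure L) 0ℓ → Set₁
IsBorelClass L = Measurable (StructureSpace L)

ClassSpace : (L : Language) → Pred (Structure L) 0ℓ → MeasurableSpace
ClassSpace L K = subspace (StructureSpace L) K

infix 4 _≅_

record _≅_ {L : Language} (A B : Structure L) : Set where
  field
    bij      : ℕ ↔ ℕ
  open Inverse bij public using (to; from)
  field
    pres-rel : ∀ R v → rel B R (map to v) ≡ rel A R v
    pres-fun : ∀ F v → fun B F (map to v) ≡ to (fun A F v)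

-- Automorphisms are identified when they agree pointwise as maps on ℕ.

Aut : {L : Language} → Structure L → Setoid 0ℓ 0ℓ
Aut A = record
  { Carrier       = A ≅ A
  ; _≈_           = λ g h → ∀ n → _≅_.to g n ≡ _≅_.to h n
  ; isEquivalence = record
      { refl  = λ n → refl
      ; sym   = λ p n → sym (p n)
      ; trans = λ p q n → trans (p n) (q n)
      }
  }

AtMostCountable : Setoid 0ℓ 0ℓ → Set
AtMostCountable X = Injection X (setoid ℕ)

IsomorphismRelation : {L : Language} (K : Pred (Structure L) 0ℓ) →
                      Pred (Σ (Structure L) K × Σ (Structure L) K) 0ℓ
IsomorphismRelation K (A , B) = proj₁ A ≅ proj₁ B

graphLanguage : Language
graphLanguage = record
  { Rel      = ⊤
  ; relArity = λ _ → 2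
  ; Fun      = ⊥
  ; funArity = λ ()
  }

adj : Structure graphLanguage → ℕ → ℕ → Bool
adj A x y = rel A tt (x ∷ y ∷ [])

IsGraph : Pred (Structure graphLanguage) 0ℓ
IsGraph A = (∀ x → adj A x x ≡ false) × (∀ x y → adj A x y ≡ adj A y x)

GraphSpace : MeasurableSpace
GraphSpace = ClassSpace graphLanguage IsGraph

BorelComplete : (L : Language) → Pred (Structure L) 0ℓ → Set₁
BorelComplete L K =
  ∃ λ (f : Carrier GraphSpace → Carrier (ClassSpace L K)) →
    MeasurableMap GraphSpace (ClassSpace L K) f ×
    (∀ A B → (proj₁ A ≅ proj₁ B) ⇔ (proj₁ (f A) ≅ proj₁ (f B)))

{-# OPTIONS --safe #-}
module Submission where

-- A structure with countably many automorphisms is rigid over {0,…,n-1} for some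
-- n: otherwise, composing automorphisms that fix longer and longer initial
-- segments, one builds an automorphism different from each of the countably many.
-- The sets of A ∈ K not rigid over {0,…,n-1} are analytic with empty intersection,
-- so by Novikov's theorem K is a countable union of Borel sets D n whose members
-- are rigid over {0,…,n-1}. For A ∈ D n an isomorphism g : A → B is determined by
-- its values s on {0,…,n-1}, so "g c = d" and "g c ≠ d" are disjoint analytic
-- conditions on (A, B). Borel sets separating them define a Borel candidate for g,
-- and A ≅ B iff the candidate for some n and s is an isomorphism.
--
-- A Borel reduction would then make isomorphism of graphs Borel. To a tree T one
-- attaches two graphs that are isomorphic iff T has an infinite path: over a node
-- σ put the finite sets e of children of σ, joining e to the sets e′ over the child
-- i when [i ∈ e] = |e′| mod 2. An isomorphism shifts the parity over σ by some g σ,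
-- and g σ = 1 forces g = 1 at some child. Marks force g = 1 at the root and g = 0
-- off T, and finite supports leave room exactly for the infinite paths. But the
-- set of codes of trees with an infinite path is not Borel, by diagonalisation over
-- codes of analytic sets.

open import Defs
open import Data.Bool.Base using (Bool; true; false; not)
open import Data.Bool.Properties using (not-involutive)
open import Data.Empty using (⊥; ⊥-elim)
open import Data.List.Base using (List; []; _∷_; length)
open import Data.List.Properties using (∷-injectiveˡ; ∷-injectiveʳ)
open import Data.Nat.Base
  using (ℕ; zero; suc; _⊔_; _≤_; _<_; _≤′_; ≤′-refl; ≤′-step; z≤n; s≤s⁻¹; _≡ᵇ_)
open import Data.Nat.Properties
open import Data.Product.Base using (Σ; ∃; ∃₂; _×_; _,_; proj₁; proj₂)
open import Data.Sum.Base using (_⊎_; inj₁; inj₂; [_,_]′)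
open import Data.Unit.Base using (tt)
open import Data.Vec.Base using (Vec; []; _∷_; map)
open import Data.Vec.Properties using (map-cong; map-∘; map-id)
open import Function.Bundles using (Injection; Inverse; mk↔ₛ′; _⇔_; mk⇔; Equivalence)
open import Function.Properties.Inverse using (↔-refl; ↔-sym; ↔-trans)
open import Function.Base using (_∘_; id; case_of_)
open import Level using (0ℓ)
open import Relation.Binary.PropositionalEquality
  using (_≡_; _≢_; refl; sym; trans; cong; cong₂; subst; subst₂; ≢-sym)
open import Relation.Nullary.Decidable using (Dec; yes; no; does; dec-true; dec-false; does-⇔)
open import Relation.Nullary.Negation.Core using (¬_; contradiction)
open import Relation.Unary using (Pred; U; ∅; ∁; ⋃; ⋂; _∩_; _∪_; _≐_; _⊆_; _⊢_)

-- Countable sets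

Countable : Set → Set
Countable A = Σ (A → ℕ) λ f → ∀ {a b} → f a ≡ f b → a ≡ b

double : ℕ → ℕ
double zero    = zero
double (suc n) = suc (suc (double n))

double-injective : ∀ {m n} → double m ≡ double n → m ≡ n
double-injective {zero}  {zero}  eq = refl
double-injective {suc m} {suc n} eq = cong suc (double-injective (suc-injective (suc-injective eq)))

double≢suc-double : ∀ {m n} → double m ≢ suc (double n)
double≢suc-double {suc m} {suc n} eq = double≢suc-double (suc-injective (suc-injective eq))

-- 2ᵐ (2 n + 1)
pair : ℕ → ℕ → ℕ
pair zero    n = suc (double n)
pair (suc m) n = double (pair m n)

pair-injective : ∀ {a b} m n → pair a b ≡ pair m n → a ≡ m × b ≡ n
pair-injective {zero}  zero    n eq = refl , double-injective (suc-injective eq)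
pair-injective {zero}  (suc m) n eq = contradiction (sym eq) double≢suc-double
pair-injective {suc a} zero    n eq = contradiction eq double≢suc-double
pair-injective {suc a} (suc m) n eq
  with refl , eq′ ← pair-injective {a} m n (double-injective eq) = refl , eq′

pair≢0 : ∀ m n → pair m n ≢ 0
pair≢0 (suc m) n eq = pair≢0 m n (double-injective {n = 0} eq)

ℕ-countable : Countable ℕ
ℕ-countable = id , id

injection-countable : ∀ {A B} (f : A → B) → (∀ {a b} → f a ≡ f b → a ≡ b) → Countable B → Countable A
injection-countable f inj (g , inj′) = g ∘ f , inj ∘ inj′

Σ-countable : ∀ {A} {B : A → Set} → Countable A → (∀ a → Countable (B a)) → Countable (Σ A B)
Σ-countable {A} {B} (f , inj) cB = (λ (a , b) → pair (f a) (proj₁ (cB a) b)) , λ {p} {q} → injective p q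
  where
  injective : ∀ (p q : Σ A B) → pair (f (proj₁ p)) (proj₁ (cB (proj₁ p)) (proj₂ p))
                              ≡ pair (f (proj₁ q)) (proj₁ (cB (proj₁ q)) (proj₂ q)) → p ≡ q
  injective (a , b) (a′ , b′) eq with pair-injective {f a} (f a′) _ eq
  ... | fa≡fa′ , eq′ with refl ← inj fa≡fa′ = cong (a ,_) (proj₂ (cB a) eq′)

×-countable : ∀ {A B} → Countable A → Countable B → Countable (A × B)
×-countable cA cB = Σ-countable cA (λ _ → cB)

Vec-countable : ∀ {A} → Countable A → ∀ n → Countable (Vec A n)
Vec-countable cA zero    = (λ _ → 0) , λ { {[]} {[]} _ → refl }
Vec-countable cA (suc n) = injection-countable
  (λ { (x ∷ xs) → x , xs }) (λ { {x ∷ xs} {y ∷ ys} refl → refl })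
  (×-countable cA (Vec-countable cA n))

code : List ℕ → ℕ
code []       = 0
code (x ∷ xs) = pair x (code xs)

code-injective : ∀ {xs ys} → code xs ≡ code ys → xs ≡ ys
code-injective {[]}     {[]}     eq = refl
code-injective {[]}     {y ∷ ys} eq = contradiction (sym eq) (pair≢0 y (code ys))
code-injective {x ∷ xs} {[]}     eq = contradiction eq (pair≢0 x (code xs))
code-injective {x ∷ xs} {y ∷ ys} eq with pair-injective {x} y (code ys) eq
... | refl , eq′ = cong (x ∷_) (code-injective eq′)

-- Initial segments

Seq : Set
Seq = ℕ → ℕ

infix 8 _↾_

-- Initial segments are listed backwards.
_↾_ : Seq → ℕ → List ℕ
y ↾ zero  = []
y ↾ suc n = y n ∷ y ↾ n

length-↾ : ∀ y n → length (y ↾ n) ≡ n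
length-↾ y zero    = refl
length-↾ y (suc n) = cong suc (length-↾ y n)

↾-lookup : ∀ {y z : Seq} n → y ↾ n ≡ z ↾ n → ∀ {j} → j < n → y j ≡ z j
↾-lookup (suc n) eq j<sn with m≤n⇒m<n∨m≡n (s≤s⁻¹ j<sn)
... | inj₁ j<n  = ↾-lookup n (∷-injectiveʳ eq) j<n
... | inj₂ refl = ∷-injectiveˡ eq

↾-cong : ∀ {y z : Seq} n → (∀ {j} → j < n → y j ≡ z j) → y ↾ n ≡ z ↾ n
↾-cong zero    h = refl
↾-cong (suc n) h = cong₂ _∷_ (h ≤-refl) (↾-cong n (h ∘ m<n⇒m<1+n))

↾-mono : ∀ {y z : Seq} {m n} → m ≤ n → y ↾ n ≡ z ↾ n → y ↾ m ≡ z ↾ m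
↾-mono {n = n} m≤n eq = ↾-cong _ (λ j<m → ↾-lookup n eq (<-≤-trans j<m m≤n))

reindex-modulus : ∀ (r : ℕ → ℕ) n →
                  ∃ λ k → ∀ {y z : Seq} → y ↾ k ≡ z ↾ k → (y ∘ r) ↾ n ≡ (z ∘ r) ↾ n
reindex-modulus r zero    = 0 , λ _ → refl
reindex-modulus r (suc n) with k , h ← reindex-modulus r n =
  suc (r n) ⊔ k , λ eq →
    cong₂ _∷_ (↾-lookup (suc (r n) ⊔ k) eq (m≤m⊔n (suc (r n)) k))
              (h (↾-mono (m≤n⊔m (suc (r n)) k) eq))

Open : Pred Seq 0ℓ → Set
Open P = ∀ {y} → P y → ∃ λ n → ∀ {z} → z ↾ n ≡ y ↾ n → P z

Open-reindex : ∀ {P} (r : ℕ → ℕ) → Open P → Open (λ y → P (y ∘ r))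
Open-reindex r oP p with n , h ← oP p with k , h′ ← reindex-modulus r n = k , λ eq → h (h′ eq)

Open-× : ∀ {P Q} → Open P → Open Q → Open (P ∩ Q)
Open-× oP oQ (p , q) with m , f ← oP p | n , g ← oQ q =
  m ⊔ n , λ eq → f (↾-mono (m≤m⊔n m n) eq) , g (↾-mono (m≤n⊔m m n) eq)

Open-⊎ : ∀ {P Q} → Open P → Open Q → Open (P ∪ Q)
Open-⊎ oP oQ (inj₁ p) with n , f ← oP p = n , inj₁ ∘ f
Open-⊎ oP oQ (inj₂ q) with n , g ← oQ q = n , inj₂ ∘ g

Open-∃ : ∀ {I : Set} {P : I → Pred Seq 0ℓ} → (∀ i → Open (P i)) → Open (λ y → ∃ λ i → P i y)
Open-∃ oP (i , p) with n , f ← oP i p = n , λ eq → i , f eq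

Open-const : ∀ {P : Set} → Open (λ _ → P)
Open-const p = 0 , λ _ → p

Open-at : ∀ (P : Pred ℕ 0ℓ) j → Open (λ y → P (y j))
Open-at P j p = suc j , λ eq → subst P (sym (∷-injectiveˡ eq)) p

Open-split : ∀ {P : ℕ → Pred Seq 0ℓ} j → (∀ m → Open (P m)) → Open (λ y → P (y j) y)
Open-split {P} j oP {y} p with n , f ← oP (y j) p =
  suc j ⊔ n , λ {z} eq →
    subst (λ m → P m z) (sym (↾-lookup (suc j ⊔ n) eq (m≤m⊔n (suc j) n))) (f (↾-mono (m≤n⊔m (suc j) n) eq))

-- Coordinate spaces

-- The field `realise` says that the range of `value` is a full product of subsets of ℕ. It lets a
-- point be built coordinate by coordinate even where a coordinate takes only the values 0 and 1.
record Coordinates (X : Set) : Set₁ where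
  field
    Index   : Set
    value   : X → Index → ℕ
    default   : X
    realise : (f : Index → ℕ) → (∀ i → ∃ λ x → value x i ≡ f i) →
              ∃ λ x → ∀ i → value x i ≡ f i

open Coordinates

-- A demand for `never` rejects a witness outright, whatever the point.
data Literal (I : Set) : Set where
  never : Literal I
  _is_  : I → ℕ → Literal I

Holds : ∀ {X} (C : Coordinates X) → Literal (Index C) → Pred X 0ℓ
Holds C never    x = ⊥
Holds C (i is m) x = value C x i ≡ m

data Cylinder {X : Set} (C : Coordinates X) : Pred X 0ℓ → Set₁ where
  cylinder : ∀ i m → Cylinder C (λ x → value C x i ≡ m)

space : ∀ {X} → Coordinates X → MeasurableSpace
space {X} C = generate X (Cylinder C)

baire : Coordinates Seq
baire = record
  { Index = ℕ ; value = id ; default = λ _ → 0 ; realise = λ f _ → f , λ _ → refl }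

infixr 2 _×ᶜ_

_×ᶜ_ : ∀ {X Y} → Coordinates X → Coordinates Y → Coordinates (X × Y)
C ×ᶜ D = record
  { Index   = Index C ⊎ Index D
  ; value   = λ (x , y) → [ value C x , value D y ]′
  ; default   = default C , default D
  ; realise = λ f h →
      let x , p = realise C (f ∘ inj₁) (λ i → let (x , _) , e = h (inj₁ i) in x , e)
          y , q = realise D (f ∘ inj₂) (λ i → let (_ , y) , e = h (inj₂ i) in y , e)
      in (x , y) , λ { (inj₁ i) → p i ; (inj₂ j) → q j }
  }

-- Analytic sets

-- A projection of a closed set: y is a witness for x when x satisfies all the
-- literals demanded by y, each of which is demanded by an initial segment of y.
record Analytic {X : Set} (C : Coordinates X) (S : Pred X 0ℓ) : Set₁ where
  field
    Demands      : Seq → Pred (Literal (Index C)) 0ℓ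
    Demands-open : ∀ l → Open (λ y → Demands y l)
    member       : S ≐ (λ x → ∃ λ y → ∀ l → Demands y l → Holds C l x)

open Analytic

module _ {X : Set} {C : Coordinates X} where

  ≐-analytic : ∀ {S T} → S ≐ T → Analytic C S → Analytic C T
  ≐-analytic (S⊆T , T⊆S) a = record
    { Demands = Demands a ; Demands-open = Demands-open a
    ; member = proj₁ (member a) ∘ T⊆S , S⊆T ∘ proj₂ (member a) }

  cylinder-analytic : ∀ i m → Analytic C (λ x → value C x i ≡ m)
  cylinder-analytic i m = record
    { Demands = λ _ → (i is m) ≡_
    ; Demands-open = λ l → Open-const
    ; member = (λ p → (λ _ → 0) , λ { _ refl → p }) , (λ (y , h) → h (i is m) refl) }

  -- The witness guesses the value of coordinate `i` as `y 0`; the guess `m` is rejected by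
  -- demanding `never`.
  cylinder-compl-analytic : ∀ i m → Analytic C (∁ (λ x → value C x i ≡ m))
  cylinder-compl-analytic i m = record
    { Demands = λ y l → (y 0 ≡ m × never ≡ l) ⊎ ((i is y 0) ≡ l)
    ; Demands-open = λ l → Open-at (λ k → (k ≡ m × never ≡ l) ⊎ ((i is k) ≡ l)) 0
    ; member =
        (λ {x} ≢m → (λ _ → value C x i) , λ { _ (inj₁ (≡m , refl)) → ≢m ≡m ; _ (inj₂ refl) → refl })
      , (λ (y , h) ≡m → h never (inj₁ (trans (sym (h (i is y 0) (inj₂ refl))) ≡m , refl))) }

  U-analytic : Analytic C U
  U-analytic = record
    { Demands = λ _ _ → ⊥ ; Demands-open = λ _ () ; member = (λ _ → (λ _ → 0) , λ _ ()) , _ }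

  ∅-analytic : Analytic C (∁ U)
  ∅-analytic = record
    { Demands = λ _ → never ≡_ ; Demands-open = λ _ → Open-const
    ; member = (λ ¬⊤ → ⊥-elim (¬⊤ tt)) , (λ (y , h) → ⊥-elim (h never refl)) }

  ⋃-analytic : ∀ {S : ℕ → Pred X 0ℓ} → (∀ n → Analytic C (S n)) → Analytic C (⋃ ℕ S)
  ⋃-analytic {S} a = record
    { Demands = λ y → Demands (a (y 0)) (y ∘ suc)
    ; Demands-open = λ l → Open-split {λ m y → Demands (a m) (y ∘ suc) l} 0
                             (λ m → Open-reindex suc (Demands-open (a m) l))
    ; member =
        (λ (n , s) → let y , h = proj₁ (member (a n)) s in (λ { zero → n ; (suc k) → y k }) , h)
      , (λ (y , h) → y 0 , proj₂ (member (a (y 0))) (y ∘ suc , h)) }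

-- Classical principles and closure properties of analytic sets

module Classical (em : ClassicalLogic) where

  lem : ∀ {ℓ} {P : Set ℓ} → Dec P
  lem {ℓ} = em ℓ

  by-contradiction : ∀ {ℓ} {P : Set ℓ} → ¬ ¬ P → P
  by-contradiction {P = P} ¬¬p with lem {P = P}
  ... | yes p = p
  ... | no ¬p = contradiction ¬p ¬¬p

  ¬∀⇒∃¬ : ∀ {a p} {A : Set a} {P : A → Set p} → ¬ (∀ a → P a) → ∃ λ a → ¬ P a
  ¬∀⇒∃¬ ¬h = by-contradiction λ ¬e → ¬h λ a → by-contradiction λ ¬p → ¬e (a , ¬p)

  private
    -- The decision is an argument because `lem` does not compute: a fact is proved for every
    -- decision and then applied to `lem`. The same device recurs in `selected`, `T` and `twistᵈ`.
    extend-dec : ∀ {A B : Set} {f : A → ℕ} {n} → (A → B) → B → Dec (∃ λ a → f a ≡ n) → B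
    extend-dec g b (yes (a , _)) = g a
    extend-dec g b (no _)        = b

  extend : ∀ {A B : Set} → (A → ℕ) → (A → B) → B → ℕ → B
  extend f g b n = extend-dec {f = f} {n} g b lem

  extend-∘ : ∀ {A B : Set} ((f , inj) : Countable A) (g : A → B) {b} a → extend f g b (f a) ≡ g a
  extend-∘ (f , inj) g {b} a = lemma lem
    where
    lemma : (d : Dec (∃ λ a′ → f a′ ≡ f a)) → extend-dec {f = f} g b d ≡ g a
    lemma (yes (a′ , eq)) = cong g (inj eq)
    lemma (no ∄)          = contradiction (a , refl) ∄

  extend-∉ : ∀ {A B : Set} {f : A → ℕ} {g : A → B} {b n} → ¬ (∃ λ a → f a ≡ n) → extend f g b n ≡ b
  extend-∉ {f = f} {g} {b} {n} ∄ = lemma lem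
    where
    lemma : (d : Dec (∃ λ a → f a ≡ n)) → extend-dec {f = f} g b d ≡ b
    lemma (yes a) = contradiction a ∄
    lemma (no _)  = refl

  merge : (ℕ → Seq) → Seq
  merge ys = extend {ℕ × ℕ} (λ (i , j) → pair i j) (λ (i , j) → ys i j) 0

  merge-pair : ∀ ys i j → merge ys (pair i j) ≡ ys i j
  merge-pair ys i j = extend-∘ (×-countable ℕ-countable ℕ-countable) (λ (i , j) → ys i j) (i , j)

  -- Sequences such as the columns of `merge` are known only pointwise. An open predicate is settled
  -- by finitely many values, so pointwise agreement is enough.
  Open-resp : ∀ {P y z} → Open P → (∀ j → z j ≡ y j) → P y → P z
  Open-resp oP eq p with n , f ← oP p = f (↾-cong n (λ {j} _ → eq j))

  module _ {X : Set} {C : Coordinates X} where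

    -- One sequence carries witnesses for all the sets, the `n`-th as its column `y ∘ pair n`, and
    -- their demands are pooled.
    ⋂-analytic : ∀ {S : ℕ → Pred X 0ℓ} → (∀ n → Analytic C (S n)) → Analytic C (⋂ ℕ S)
    ⋂-analytic {S} a = record
      { Demands = λ y l → ∃ λ n → Demands (a n) (y ∘ pair n) l
      ; Demands-open = λ l → Open-∃ (λ n → Open-reindex (pair n) (Demands-open (a n) l))
      ; member =
          (λ s → let ys = λ n → proj₁ (proj₁ (member (a n)) (s n)) in
            merge ys , λ { l (n , d) → proj₂ (proj₁ (member (a n)) (s n)) l
              (Open-resp (Demands-open (a n) l) (λ j → sym (merge-pair ys n j)) d) })
        , (λ (y , h) n → proj₂ (member (a n)) (y ∘ pair n , λ l d → h l (n , d))) }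

    -- The new witness holds the old one in column 0 and the projected point `g` in column 1.
    -- Demands on `x` are passed on; a demand on `g` is compared with column 1, and a mismatch,
    -- visible at a finite stage, becomes a demand for `never`.
    projection-analytic : ∀ {S : Pred (X × Seq) 0ℓ} → Analytic (C ×ᶜ baire) S →
                          Analytic C (λ x → ∃ λ g → S (x , g))
    projection-analytic {S} a = record
      { Demands = demands
      ; Demands-open = demands-open
      ; member = forth , back }
      where
      I = Index C

      demands : Seq → Pred (Literal I) 0ℓ
      demands y never    = Demands a (y ∘ pair 0) never ⊎
                           ∃₂ λ j m → Demands a (y ∘ pair 0) (inj₂ j is m) × y (pair 1 j) ≢ m
      demands y (i is m) = Demands a (y ∘ pair 0) (inj₁ i is m)

      demands-open : ∀ l → Open (λ y → demands y l)
      demands-open never    = Open-⊎ (Open-reindex (pair 0) (Demands-open a never))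
        (Open-∃ λ j → Open-∃ λ m → Open-×
          (Open-reindex (pair 0) (Demands-open a (inj₂ j is m)))
          (Open-at (_≢ m) (pair 1 j)))
      demands-open (i is m) = Open-reindex (pair 0) (Demands-open a (inj₁ i is m))

      forth : ∀ {x} → (∃ λ g → S (x , g)) → ∃ λ y → ∀ l → demands y l → Holds C l x
      forth {x} (g , s) = y , h
        where
        z : Seq
        z = proj₁ (proj₁ (member a) s)

        ys : ℕ → Seq
        ys zero    = z
        ys (suc _) = g

        y : Seq
        y = merge ys

        unmerge : ∀ l → Demands a (y ∘ pair 0) l → Holds (C ×ᶜ baire) l (x , g)
        unmerge l d = proj₂ (proj₁ (member a) s) l
          (Open-resp (Demands-open a l) (λ j → sym (merge-pair ys 0 j)) d)

        h : ∀ l → demands y l → Holds C l x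
        h never    (inj₁ d)                = unmerge never d
        h never    (inj₂ (j , m , d , ≢m)) = ≢m (trans (merge-pair ys 1 j) (unmerge _ d))
        h (i is m) d                       = unmerge _ d

      back : ∀ {x} → (∃ λ y → ∀ l → demands y l → Holds C l x) → ∃ λ g → S (x , g)
      back {x} (y , h) = y ∘ pair 1 , proj₂ (member a) (y ∘ pair 0 , h′)
        where
        h′ : ∀ l → Demands a (y ∘ pair 0) l → Holds (C ×ᶜ baire) l (x , y ∘ pair 1)
        h′ never         d = h never (inj₁ d)
        h′ (inj₁ i is m) d = h (i is m) d
        h′ (inj₂ j is m) d = by-contradiction λ ≢m → h never (inj₂ (j , m , d , ≢m))

    -- Analyticity alone does not survive complements. Carrying the set and its complement together
    -- makes that case a swap.
    Borel⇒analytic×coanalytic : ∀ {S} → Measurable (space C) S → Analytic C S × Analytic C (∁ S)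
    Borel⇒analytic×coanalytic (gen (cylinder i m)) = cylinder-analytic i m , cylinder-compl-analytic i m
    Borel⇒analytic×coanalytic (resp (S⊆T , T⊆S) b) with a , a′ ← Borel⇒analytic×coanalytic b =
      ≐-analytic (S⊆T , T⊆S) a , ≐-analytic ((λ ¬s t → ¬s (T⊆S t)) , (λ ¬t s → ¬t (S⊆T s))) a′
    Borel⇒analytic×coanalytic univ = U-analytic , ∅-analytic
    Borel⇒analytic×coanalytic (compl b) with a , a′ ← Borel⇒analytic×coanalytic b =
      a′ , ≐-analytic ((λ s ¬s → ¬s s) , by-contradiction) a
    Borel⇒analytic×coanalytic (union b) =
        ⋃-analytic (λ n → proj₁ (Borel⇒analytic×coanalytic (b n)))
      , ≐-analytic ((λ h (n , s) → h n s) , (λ h n s → h (n , s)))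
          (⋂-analytic (λ n → proj₂ (Borel⇒analytic×coanalytic (b n))))

    Borel⇒analytic : ∀ {S} → Measurable (space C) S → Analytic C S
    Borel⇒analytic = proj₁ ∘ Borel⇒analytic×coanalytic

  -- Closure properties of measurable sets

  module Measure (Z : MeasurableSpace) where
    private module Z = MeasurableSpace Z

    ∅-measurable : Measurable Z ∅
    ∅-measurable = Z.resp ((λ ¬⊤ → ¬⊤ tt) , λ ()) (Z.compl Z.univ)

    ⋂-measurable : ∀ {S : ℕ → Pred (Carrier Z) 0ℓ} → (∀ n → Measurable Z (S n)) → Measurable Z (⋂ ℕ S)
    ⋂-measurable m = Z.resp
      ((λ h n → by-contradiction λ ¬s → h (n , ¬s)) , (λ h (n , ¬s) → ¬s (h n)))
      (Z.compl (Z.union (λ n → Z.compl (m n))))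

    ∪-measurable : ∀ {S T} → Measurable Z S → Measurable Z T → Measurable Z (S ∪ T)
    ∪-measurable {S} {T} mS mT = Z.resp
      ((λ { (zero , s) → inj₁ s ; (suc _ , t) → inj₂ t })
      , (λ { (inj₁ s) → 0 , s ; (inj₂ t) → 1 , t }))
      (Z.union {S = λ { zero → S ; (suc _) → T }} λ { zero → mS ; (suc _) → mT })

    ∩-measurable : ∀ {S T} → Measurable Z S → Measurable Z T → Measurable Z (S ∩ T)
    ∩-measurable mS mT = Z.resp
      ((λ h → by-contradiction (h ∘ inj₁) , by-contradiction (h ∘ inj₂))
      , (λ { (s , t) (inj₁ ¬s) → ¬s s ; (s , t) (inj₂ ¬t) → ¬t t }))
      (Z.compl (∪-measurable (Z.compl mS) (Z.compl mT)))

    →-measurable : ∀ {S T} → Measurable Z S → Measurable Z T → Measurable Z (λ z → S z → T z)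
    →-measurable mS mT = Z.resp
      ((λ { (inj₁ ¬s) s → contradiction s ¬s ; (inj₂ t) _ → t })
      , (λ {z} h → case lem of λ { (yes s) → inj₂ (h s) ; (no ¬s) → inj₁ ¬s }))
      (∪-measurable (Z.compl mS) mT)

    -- By excluded middle this is the whole space or the empty set. It disposes of side conditions
    -- that do not mention the point.
    const-measurable : ∀ {P : Set} → Measurable Z (λ _ → P)
    const-measurable {P} with lem {P = P}
    ... | yes p = Z.resp ((λ _ → p) , (λ _ → tt)) Z.univ
    ... | no ¬p = Z.resp ((λ ()) , ¬p) ∅-measurable

    ∃-measurable : ∀ {A : Set} {S : A → Pred (Carrier Z) 0ℓ} → Countable A →
                   (∀ a → Measurable Z (S a)) → Measurable Z (λ z → ∃ λ a → S a z)
    ∃-measurable {A} {S} (f , inj) m = Z.resp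
      ((λ (n , a , _ , s) → a , s) , (λ (a , s) → f a , a , refl , s))
      (Z.union fibre)
      where
      fibre : ∀ n → Measurable Z (λ z → ∃ λ a → f a ≡ n × S a z)
      fibre n with lem {P = ∃ λ a → f a ≡ n}
      ... | no ∄ = Z.resp ((λ ()) , λ (a , eq , _) → ∄ (a , eq)) ∅-measurable
      ... | yes (a , refl) = Z.resp
        ((λ s → a , refl , s) , (λ {z} (a′ , eq , s) → subst (λ a → S a z) (inj eq) s)) (m a)

    ∀-measurable : ∀ {A : Set} {S : A → Pred (Carrier Z) 0ℓ} → Countable A →
                   (∀ a → Measurable Z (S a)) → Measurable Z (λ z → ∀ a → S a z)
    ∀-measurable cA m = Z.resp
      ((λ h a → by-contradiction λ ¬s → h (a , ¬s)) , (λ h (a , ¬s) → ¬s (h a)))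
      (Z.compl (∃-measurable cA (λ a → Z.compl (m a))))

  -- Novikov's separation theorem

  module _ {X : Set} (C : Coordinates X) where
    private module B = MeasurableSpace (space C)
    open Measure (space C)

    Separated : (ℕ → Pred X 0ℓ) → Set₁
    Separated P = ∃ λ (R : ℕ → Pred X 0ℓ) →
      (∀ n → Measurable (space C) (R n)) × (∀ n → P n ⊆ R n) × (∀ x → ¬ (∀ n → R n x))

    -- If the sets cannot be separated, then some one-step extension of every inseparable stage is
    -- inseparable, which yields a branch `limit`. The literals demanded along it are pairwise
    -- consistent, so a single point satisfies them all and lies in every `P n`, against
    -- disjointness.
    module Novikov {P : ℕ → Pred X 0ℓ} (a : ∀ n → Analytic C (P n)) where

      D : ℕ → Seq → Pred (Literal (Index C)) 0ℓ
      D n y = Demands (a n) (y ∘ pair n)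

      D-open : ∀ n l → Open (λ y → D n y l)
      D-open n l = Open-reindex (pair n) (Demands-open (a n) l)

      -- One sequence y carries the witnesses of all the P n, as y (pair n _).
      Stage : ℕ → List ℕ → ℕ → Pred X 0ℓ
      Stage k s n x = ∃ λ y → y ↾ k ≡ s × (∀ l → D n y l → Holds C l x)

      set : Seq → ℕ → ℕ → Seq
      set y k m j with j ≟ k
      ... | yes _ = m
      ... | no  _ = y j

      set-≡ : ∀ y k m → set y k m k ≡ m
      set-≡ y k m with k ≟ k
      ... | yes _  = refl
      ... | no k≢k = contradiction refl k≢k

      set-≢ : ∀ y k m {j} → j ≢ k → set y k m j ≡ y j
      set-≢ y k m {j} j≢k with j ≟ k
      ... | yes j≡k = contradiction j≡k j≢k
      ... | no _    = refl

      set-↾ : ∀ y k m → set y k m ↾ suc k ≡ m ∷ y ↾ k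
      set-↾ y k m = cong₂ _∷_ (set-≡ y k m) (↾-cong k λ j<k → set-≢ y k m (<⇒≢ j<k))

      -- The value of y at k matters to at most one of the sets.
      Separated-split : ∀ k s → (∀ m → Separated (Stage (suc k) (m ∷ s))) → Separated (Stage k s)
      Separated-split k s sep = (λ n → T n (owns? n)) , (λ n → T-measurable n (owns? n))
                              , (λ n → T-covers n (owns? n)) , empty
        where
        R : ℕ → ℕ → Pred X 0ℓ
        R m = proj₁ (sep m)

        Owns : ℕ → Set
        Owns n = ∃ λ j → pair n j ≡ k

        owns? : ∀ n → Dec (Owns n)
        owns? n = lem

        -- The owner of position `k` may have any value there, hence a union over `m`. A set that
        -- does not own `k` has stages insensitive to `y k`, so each of its covers works and they
        -- may be intersected.
        T : ∀ n → Dec (Owns n) → Pred X 0ℓ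
        T n (yes _) x = ∃ λ m → R m n x
        T n (no _)  x = ∀ m → R m n x

        T-measurable : ∀ n d → Measurable (space C) (T n d)
        T-measurable n (yes _) = B.union (λ m → proj₁ (proj₂ (sep m)) n)
        T-measurable n (no _)  = ⋂-measurable (λ m → proj₁ (proj₂ (sep m)) n)

        T-covers : ∀ n d → Stage k s n ⊆ T n d
        T-covers n (yes _) (y , eq , h) =
          y k , proj₁ (proj₂ (proj₂ (sep (y k)))) n (y , cong (y k ∷_) eq , h)
        T-covers n (no ¬owns) (y , eq , h) m =
          proj₁ (proj₂ (proj₂ (sep m))) n
            ( set y k m
            , trans (set-↾ y k m) (cong (m ∷_) eq)
            , λ l d → h l (Open-resp (Demands-open (a n) l)
                             (λ j → sym (set-≢ y k m λ e → ¬owns (j , e))) d))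

        empty : ∀ x → ¬ (∀ n → T n (owns? n) x)
        empty x t with lem {P = ∃ Owns}
        -- Some positions, such as 0, are not of the form `pair n j`. Then every `T n` is an
        -- intersection, and 0 stands for an arbitrary `m`.
        ... | no ∄owner = proj₂ (proj₂ (proj₂ (sep 0))) x (λ n → unowned n (owns? n) (t n))
          where
          unowned : ∀ n d → T n d x → R 0 n x
          unowned n (yes o) _ = contradiction (n , o) ∄owner
          unowned n (no _)  r = r 0
        -- The union for the owner supplies an index `m₀`. All the other sets are intersections, so
        -- `x` would lie in every `R m₀ n`.
        ... | yes (n₀ , j₀ , e₀) = proj₂ (proj₂ (proj₂ (sep m₀))) x (λ n → all n (owns? n) (t n))
          where
          owned : ∀ d → T n₀ d x → ∃ λ m → R m n₀ x
          owned (yes _) r = r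
          owned (no ¬o) _ = contradiction (j₀ , e₀) ¬o

          m₀ : ℕ
          m₀ = proj₁ (owned (owns? n₀) (t n₀))

          all : ∀ n d → T n d x → R m₀ n x
          all n (no _)        r = r m₀
          all n (yes (j , e)) _ with refl , _ ← pair-injective {n} n₀ j₀ (trans e (sym e₀)) =
            proj₂ (owned (owns? n₀) (t n₀))

      module _ (disjoint : ∀ x → ¬ (∀ n → P n x)) (¬sep : ¬ Separated P) where

        ¬Separated-Stage₀ : ¬ Separated (Stage 0 [])
        ¬Separated-Stage₀ (R , mR , cov , emp) = ¬sep (R , mR , cover , emp)
          where
          cover : ∀ n → P n ⊆ R n
          cover n p with y , h ← proj₁ (member (a n)) p =
            -- Only column `n` is read here, so the other columns may repeat `y`.
            cov n (merge (λ _ → y) , refl , λ l d → h l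
              (Open-resp (Demands-open (a n) l) (λ j → sym (merge-pair (λ _ → y) n j)) d))

        stage : ∀ k → ∃ λ s → ¬ Separated (Stage k s)
        next : ∀ k → ∃ λ m → ¬ Separated (Stage (suc k) (m ∷ proj₁ (stage k)))

        stage zero    = [] , ¬Separated-Stage₀
        stage (suc k) = proj₁ (next k) ∷ proj₁ (stage k) , proj₂ (next k)

        next k = ¬∀⇒∃¬ (λ sep → proj₂ (stage k) (Separated-split k (proj₁ (stage k)) sep))

        limit : Seq
        limit k = proj₁ (next k)

        limit-↾ : ∀ k → limit ↾ k ≡ proj₁ (stage k)
        limit-↾ zero    = refl
        limit-↾ (suc k) = cong (limit k ∷_) (limit-↾ k)

        Demanded : Pred (Literal (Index C)) 0ℓ
        Demanded l = ∃ λ n → D n limit l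

        -- Both demands are already forced by `limit ↾ K` for some `K`. If no point satisfied both
        -- literals, then imposing `l` on the `n`-th set and `l′` on the `n′`-th would separate
        -- stage `K`. The case `l = l′` rules out `never`.
        consistent : ∀ {l l′} → Demanded l → Demanded l′ → ∃ λ x → Holds C l x × Holds C l′ x
        consistent {l} {l′} (n , d) (n′ , d′) = by-contradiction λ ∄x →
          proj₂ (stage K)
            ( R , (λ j → ∩-measurable (→-measurable const-measurable (Holds-measurable l))
                                      (→-measurable const-measurable (Holds-measurable l′)))
            , covers
            , λ x r → ∄x (x , proj₁ (r n) refl , proj₂ (r n′) refl))
          where
          k k′ K : ℕ
          k  = proj₁ (D-open n l {limit} d)
          k′ = proj₁ (D-open n′ l′ {limit} d′)
          K  = k ⊔ k′

          R : ℕ → Pred X 0ℓ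
          R j x = (j ≡ n → Holds C l x) × (j ≡ n′ → Holds C l′ x)

          Holds-measurable : ∀ l → Measurable (space C) (Holds C l)
          Holds-measurable never    = ∅-measurable
          Holds-measurable (i is m) = gen (cylinder i m)

          covers : ∀ j → Stage K (proj₁ (stage K)) j ⊆ R j
          covers j {x} (y , eq , h) =
              (λ { refl → h l  (proj₂ (D-open n l {limit} d)    (↾-mono (m≤m⊔n k k′) agree)) })
            , (λ { refl → h l′ (proj₂ (D-open n′ l′ {limit} d′) (↾-mono (m≤n⊔m k k′) agree)) })
            where
            agree : y ↾ K ≡ limit ↾ K
            agree = trans eq (sym (limit-↾ K))

        choose : ∀ i → Σ ℕ λ m → (∃ λ x → value C x i ≡ m) ×
                                 (∀ {m′} → Demanded (i is m′) → m ≡ m′)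
        choose i with lem {P = ∃ λ m → Demanded (i is m)}
        -- A coordinate without demands takes its value from the default point, so that the value is
        -- attained, as `realise` requires.
        ... | no ∄m = value C (default C) i , (default C , refl) , λ d → contradiction (_ , d) ∄m
        ... | yes (m , d) =
          m , (let x , p , _ = consistent d d in x , p)
            , λ d′ → let x , p , p′ = consistent d d′ in trans (sym p) p′

        absurd : ⊥
        absurd = disjoint x₀ (λ n → proj₂ (member (a n)) (limit ∘ pair n , λ l d → holds l (n , d)))
          where
          realised : ∃ λ x → ∀ i → value C x i ≡ proj₁ (choose i)
          realised = realise C (proj₁ ∘ choose) (proj₁ ∘ proj₂ ∘ choose)

          x₀ : X
          x₀ = proj₁ realised

          holds : ∀ l → Demanded l → Holds C l x₀
          holds never    d = proj₁ (proj₂ (consistent d d))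
          holds (i is m) d = trans (proj₂ realised i) (proj₂ (proj₂ (choose i)) d)

    abstract
      novikov : ∀ {P : ℕ → Pred X 0ℓ} → (∀ n → Analytic C (P n)) → (∀ x → ¬ (∀ n → P n x)) → Separated P
      novikov a disjoint = by-contradiction (Novikov.absurd a disjoint)

      -- Novikov's theorem for the sequence P, Q, Q, Q, ...: the covers of the copies of `Q` have an
      -- intersection that contains `Q` and misses `P`.
      lusin : ∀ {P Q : Pred X 0ℓ} → Analytic C P → Analytic C Q → (∀ x → P x → ¬ Q x) →
              ∃ λ R → Measurable (space C) R × P ⊆ R × (∀ x → Q x → ¬ R x)
      lusin {P} {Q} aP aQ disjoint =
        let R , mR , cov , emp = novikov {λ { zero → P ; (suc _) → Q }} (λ { zero → aP ; (suc _) → aQ })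
                                   (λ x h → disjoint x (h 0) (h 1))
        in (∁ (⋂ ℕ (R ∘ suc))) , B.compl (⋂-measurable (mR ∘ suc))
         , (λ {x} p rs → emp x λ { zero → cov 0 p ; (suc n) → rs n })
         , (λ x q ¬rs → ¬rs λ n → cov (suc n) q)

  -- Measurable functions with countable range

  module _ (Z : MeasurableSpace) where
    private module Z = MeasurableSpace Z
    open Measure Z

    MeasurableValue : ∀ {A : Set} → (Carrier Z → A) → Set₁
    MeasurableValue f = ∀ a → Measurable Z (λ z → f z ≡ a)

    MeasurableCoordinates : ∀ {X} → Coordinates X → (Carrier Z → X) → Set₁
    MeasurableCoordinates C f = ∀ i → MeasurableValue (λ z → value C (f z) i)

    const-value : ∀ {A : Set} (a : A) → MeasurableValue (λ _ → a)
    const-value a b = const-measurable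

    -- The space splits into countably many measurable pieces on which `f` is constant.
    bind-value : ∀ {A B : Set} {f : Carrier Z → A} {g : A → Carrier Z → B} → Countable A →
                 MeasurableValue f → (∀ a → MeasurableValue (g a)) → MeasurableValue (λ z → g (f z) z)
    bind-value cA mf mg b = Z.resp
      ((λ { (_ , refl , e) → e }) , (λ e → _ , refl , e))
      (∃-measurable cA (λ a → ∩-measurable (mf a) (mg a b)))

    ≡-measurable : ∀ {A : Set} {f g : Carrier Z → A} → Countable A →
                   MeasurableValue f → MeasurableValue g → Measurable Z (λ z → f z ≡ g z)
    ≡-measurable cA mf mg = Z.resp
      ((λ (a , p , q) → trans p (sym q)) , (λ e → _ , e , refl))
      (∃-measurable cA (λ a → ∩-measurable (mf a) (mg a)))

    map-value : ∀ {h : Carrier Z → Seq} → (∀ j → MeasurableValue (λ z → h z j)) →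
                ∀ {n} (v : Vec ℕ n) → MeasurableValue (λ z → map (h z) v)
    map-value mh []      []      = Z.resp ((λ _ → refl) , _) Z.univ
    map-value mh (x ∷ v) (y ∷ w) = Z.resp
      ((λ (p , q) → cong₂ _∷_ p q) , (λ { refl → refl , refl }))
      (∩-measurable (mh x y) (map-value mh v w))

    ↾-value : ∀ {h : Carrier Z → Seq} → (∀ j → MeasurableValue (λ z → h z j)) →
              ∀ n → MeasurableValue (λ z → h z ↾ n)
    ↾-value mh zero    []       = Z.resp ((λ _ → refl) , _) Z.univ
    ↾-value mh zero    (_ ∷ _)  = Z.resp ((λ ()) , λ ()) ∅-measurable
    ↾-value mh (suc n) []       = Z.resp ((λ ()) , λ ()) ∅-measurable
    ↾-value mh (suc n) (y ∷ ys) = Z.resp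
      ((λ (p , q) → cong₂ _∷_ p q) , (λ e → ∷-injectiveˡ e , ∷-injectiveʳ e))
      (∩-measurable (mh n y) (↾-value mh n ys))

    preimage-generated : ∀ {X} {G : Pred X 0ℓ → Set₁} {f : Carrier Z → X} →
                         (∀ {S} → G S → Measurable Z (f ⊢ S)) →
                         ∀ {S} → Generated G S → Measurable Z (f ⊢ S)
    preimage-generated h (gen g)    = h g
    preimage-generated h (resp e m) = Z.resp (proj₁ e , proj₂ e) (preimage-generated h m)
    preimage-generated h univ       = Z.univ
    preimage-generated h (compl m)  = Z.compl (preimage-generated h m)
    preimage-generated h (union m)  = Z.union (λ n → preimage-generated h (m n))

    preimage-space : ∀ {X} {C : Coordinates X} {f : Carrier Z → X} → MeasurableCoordinates C f →
                     ∀ {S} → Measurable (space C) S → Measurable Z (f ⊢ S)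
    preimage-space mf = preimage-generated λ { (cylinder i m) → mf i m }

    Only : (ℕ → Pred (Carrier Z) 0ℓ) → ℕ → Pred (Carrier Z) 0ℓ
    Only S d z = S d z × (∀ d′ → d′ ≢ d → ¬ S d′ z)

    selected : ∀ {S z} → Dec (∃ λ d → Only S d z) → ℕ
    selected (yes (d , _)) = d
    selected (no _)        = 0

    -- Takes the value 0 at the points lying in none or in several of the sets S d.
    select : (ℕ → Pred (Carrier Z) 0ℓ) → Carrier Z → ℕ
    select S z = selected {S} {z} lem

    selected-≡ : ∀ {S z d} (c : Dec (∃ λ d → Only S d z)) → Only S d z → selected {S} {z} c ≡ d
    selected-≡ {d = d} (yes (d′ , s , _)) (_ , o) = by-contradiction λ ≢d → o d′ ≢d s
    selected-≡         (no ∄)             o       = contradiction (_ , o) ∄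

    select-≡ : ∀ {S z d} → Only S d z → select S z ≡ d
    select-≡ = selected-≡ lem

    select-measurable : ∀ {S} → (∀ d → Measurable Z (S d)) → MeasurableValue (select S)
    select-measurable {S} mS d = Z.resp ((λ {z} → back lem) , (λ {z} → forth lem))
      -- The second set accounts for the default value 0 of `select`.
      (∪-measurable (mOnly d)
        (∩-measurable const-measurable (Z.compl (Z.union mOnly))))
      where
      mOnly : ∀ d → Measurable Z (Only S d)
      mOnly d = ∩-measurable (mS d) (∀-measurable ℕ-countable λ d′ →
        →-measurable const-measurable (Z.compl (mS d′)))

      Cases : Pred (Carrier Z) 0ℓ
      Cases z = Only S d z ⊎ (d ≡ 0 × ¬ (∃ λ d → Only S d z))

      back : ∀ {z} (c : Dec (∃ λ d → Only S d z)) → Cases z → selected {S} {z} c ≡ d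
      back c       (inj₁ o)          = selected-≡ {S} c o
      back (yes o) (inj₂ (_ , ∄))    = contradiction o ∄
      back (no _)  (inj₂ (refl , _)) = refl

      forth : ∀ {z} (c : Dec (∃ λ d → Only S d z)) → selected {S} {z} c ≡ d → Cases z
      forth (yes (_ , o)) refl = inj₁ o
      forth (no ∄)        refl = inj₂ (refl , ∄)

-- Isomorphisms

module _ {L : Language} where

  -- Bijectivity is stated without an inverse, so that an isomorphism is one point of Baire space
  -- and, for countable `L`, the condition is Borel in the two structures and that point.
  IsIso : (A B : Structure L) → Seq → Set
  IsIso A B h = (∀ a b → h a ≡ h b → a ≡ b) × (∀ d → ∃ λ c → h c ≡ d) ×
                (∀ R v → rel B R (map h v) ≡ rel A R v) ×
                (∀ F v → fun B F (map h v) ≡ h (fun A F v))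

  IsIso-resp : ∀ {A B : Structure L} {g h} → (∀ n → g n ≡ h n) → IsIso A B g → IsIso A B h
  IsIso-resp {A} {B} {g} {h} g≗h (inj , surj , pr , pf) =
      (λ a b e → inj a b (trans (g≗h a) (trans e (sym (g≗h b)))))
    , (λ d → let c , e = surj d in c , trans (sym (g≗h c)) e)
    , (λ R v → trans (cong (rel B R) (sym (map-cong g≗h v))) (pr R v))
    , (λ F v → trans (cong (fun B F) (sym (map-cong g≗h v))) (trans (pf F v) (g≗h _)))

  ≅⇒IsIso : ∀ {A B : Structure L} (g : A ≅ B) → IsIso A B (_≅_.to g)
  ≅⇒IsIso g = (λ a b e → trans (sym (strictlyInverseʳ a)) (trans (cong from e) (strictlyInverseʳ b)))
            , (λ d → from d , strictlyInverseˡ d) , pres-rel , pres-fun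
    where
    open _≅_ g
    open Inverse bij using (strictlyInverseˡ; strictlyInverseʳ)

  IsIso⇒≅ : ∀ {A B : Structure L} {h} → IsIso A B h → A ≅ B
  IsIso⇒≅ {h = h} (inj , surj , pr , pf) = record
    { bij = mk↔ₛ′ h (proj₁ ∘ surj) (proj₂ ∘ surj) (λ c → inj _ _ (proj₂ (surj (h c))))
    ; pres-rel = pr ; pres-fun = pf }

  ≅-trans : ∀ {A B C : Structure L} → A ≅ B → B ≅ C → A ≅ C
  ≅-trans {A} {B} {C} g h = record
    { bij = ↔-trans G.bij H.bij
    ; pres-rel = λ R v → trans (cong (rel C R) (map-∘ H.to G.to v)) (trans (H.pres-rel R _) (G.pres-rel R v))
    ; pres-fun = λ F v → trans (cong (fun C F) (map-∘ H.to G.to v))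
                          (trans (H.pres-fun F _) (cong H.to (G.pres-fun F v))) }
    where
    module G = _≅_ g
    module H = _≅_ h

  ≅-refl : ∀ {A : Structure L} → A ≅ A
  ≅-refl {A} = record
    { bij = ↔-refl
    ; pres-rel = λ R v → cong (rel A R) (map-id v)
    ; pres-fun = λ F v → cong (fun A F) (map-id v) }

  ≅-sym : ∀ {A B : Structure L} → A ≅ B → B ≅ A
  ≅-sym {A} {B} g = record
    { bij = ↔-sym bij
    ; pres-rel = λ R v → trans (sym (pres-rel R (map from v))) (cong (rel B R) (to-from v))
    ; pres-fun = λ F v → trans (sym (strictlyInverseʳ _))
        (cong from (trans (sym (pres-fun F (map from v))) (cong (fun B F) (to-from v)))) }
    where
    open _≅_ g
    open Inverse bij using (strictlyInverseˡ; strictlyInverseʳ)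

    to-from : ∀ {n} (v : Vec ℕ n) → map to (map from v) ≡ v
    to-from v = trans (sym (map-∘ to from v)) (trans (map-cong strictlyInverseˡ v) (map-id v))

  RigidOver : ℕ → Structure L → Set
  RigidOver n A = ∀ (h : A ≅ A) → (∀ i → i < n → _≅_.to h i ≡ i) → ∀ c → _≅_.to h c ≡ c

bool : Bool → ℕ
bool false = 0
bool true  = 1

structures : (L : Language) → Coordinates (Structure L)
structures L = record
  { Index   = (Σ (Rel L) λ R → Vec ℕ (relArity L R)) ⊎ (Σ (Fun L) λ F → Vec ℕ (funArity L F))
  ; value   = λ A → [ (λ (R , v) → bool (rel A R v)) , (λ (F , v) → fun A F v) ]′
  ; default   = record { rel = λ _ _ → false ; fun = λ _ _ → 0 }
  ; realise = λ f h →
      -- The coordinate of a relation is 0 or 1 because each single value is attained, so comparison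
      -- with 1 decodes it.
      record { rel = λ R v → f (inj₁ (R , v)) ≡ᵇ 1 ; fun = λ F v → f (inj₂ (F , v)) }
    , λ { (inj₁ (R , v)) → in-range (proj₂ (h (inj₁ (R , v)))) ; (inj₂ _) → refl }
  }
  where
  in-range : ∀ {b m} → bool b ≡ m → bool (m ≡ᵇ 1) ≡ m
  in-range {false} refl = refl
  in-range {true}  refl = refl

-- Rigidity over a finite set from countability of the automorphism group

module Rigidity (em : ClassicalLogic) {L : Language} (A : Structure L)
                (countable : AtMostCountable (Aut A)) where
  open Classical em
  open _≅_ using (to; from)

  index : A ≅ A → ℕ
  index = Injection.to countable

  index-injective : ∀ {g h} → index g ≡ index h → ∀ n → to g n ≡ to h n
  index-injective = Injection.injective countable

  to-from : ∀ (g : A ≅ A) n → to g (from g n) ≡ n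
  to-from g = Inverse.strictlyInverseˡ (_≅_.bij g)

  from-to : ∀ (g : A ≅ A) n → from g (to g n) ≡ n
  from-to g = Inverse.strictlyInverseʳ (_≅_.bij g)

  to-injective : ∀ (g : A ≅ A) {m n} → to g m ≡ to g n → m ≡ n
  to-injective g = proj₁ (≅⇒IsIso g) _ _

  bound : (f : ℕ → ℕ) → ∀ n → ∃ λ m → ∀ {i} → i < n → f i < m
  bound f zero    = 0 , λ ()
  bound f (suc n) with m , h ← bound f n = suc (f n) ⊔ m , λ i<sn → case m≤n⇒m<n∨m≡n (s≤s⁻¹ i<sn) of λ
    { (inj₁ i<n)  → <-≤-trans (h i<n) (m≤n⊔m (suc (f n)) m)
    ; (inj₂ refl) → m≤m⊔n (suc (f n)) m }

  -- Images of the points below `n` and preimages of the points below `k` are frozen; the latter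
  -- makes the limit surjective. The field `avoid` diagonalises against the automorphism of index
  -- `k` at a point `c` that is frozen from then on.
  record Step (k : ℕ) (g : A ≅ A) (n : ℕ) (g′ : A ≅ A) (n′ : ℕ) : Set where
    field
      k<n′    : k < n′
      n≤n′    : n ≤ n′
      agree   : ∀ {i} → i < n → to g′ i ≡ to g i
      agree⁻¹ : ∀ {i} → i < k → from g′ i ≡ from g i
      avoid   : ∃ λ c → c < n′ × (∀ a → index a ≡ k → to a c ≢ to g′ c)

  module _ (¬rigid : ∀ n → ¬ RigidOver n A) where

    moving : ∀ n → Σ (A ≅ A) λ h → (∀ i → i < n → to h i ≡ i) × ∃ λ c → to h c ≢ c
    moving n with h , ¬p ← ¬∀⇒∃¬ (¬rigid n) = by-contradiction λ ∄ →
      ¬p λ fixes c → by-contradiction λ moved → ∄ (h , fixes , c , moved)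

    -- Take `h` fixing the points below `n` and the preimages under `g` of the points below `k`, but
    -- moving some `c`. At `c` the maps `g` and `g ∘ h` differ, so at least one of them differs
    -- there from the automorphism of index `k`, if there is one.
    step : ∀ k g n → ∃₂ (Step k g n)
    step k g n with M₀ , bounded ← bound (from g) k
      with h , fixes , c , moved ← moving (n ⊔ M₀)
      with lem {P = ∃ λ a → index a ≡ k × to a c ≡ to g c}
    ... | no ∄a = g , suc k ⊔ (n ⊔ suc c) , record
      { k<n′ = m≤m⊔n (suc k) (n ⊔ suc c)
      ; n≤n′ = ≤-trans (m≤m⊔n n _) (m≤n⊔m (suc k) _)
      ; agree = λ _ → refl ; agree⁻¹ = λ _ → refl
      ; avoid = c , ≤-trans (m≤n⊔m n (suc c)) (m≤n⊔m (suc k) _) , λ a ia e → ∄a (a , ia , e) }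
    ... | yes (a , ia , ac) = ≅-trans h g , suc k ⊔ (n ⊔ suc c) , record
      { k<n′ = m≤m⊔n (suc k) (n ⊔ suc c)
      ; n≤n′ = ≤-trans (m≤m⊔n n _) (m≤n⊔m (suc k) _)
      ; agree = λ i<n → cong (to g) (fixes _ (<-≤-trans i<n (m≤m⊔n n M₀)))
      ; agree⁻¹ = λ i<k → trans (cong (from h) (sym (fixes _ (<-≤-trans (bounded i<k) (m≤n⊔m n M₀)))))
                                (from-to h _)
      ; avoid = c , ≤-trans (m≤n⊔m n (suc c)) (m≤n⊔m (suc k) _)
              , λ a′ ia′ e → moved (to-injective g (trans (sym e)
                  (trans (index-injective (trans ia′ (sym ia)) c) ac))) }

    approx : ℕ → (A ≅ A) × ℕ
    approx zero    = ≅-refl , 0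
    approx (suc k) = let g , n = approx k ; g′ , n′ , _ = step k g n in g′ , n′

    approx-step : ∀ k → Step k (proj₁ (approx k)) (proj₂ (approx k))
                               (proj₁ (approx (suc k))) (proj₂ (approx (suc k)))
    approx-step k = let g , n = approx k in proj₂ (proj₂ (step k g n))

  module Limit (g : ℕ → A ≅ A) (n : ℕ → ℕ) (next : ∀ k → Step k (g k) (n k) (g (suc k)) (n (suc k))) where

    k≤n : ∀ k → k ≤ n k
    k≤n zero    = z≤n
    k≤n (suc k) = Step.k<n′ (next k)

    n-mono : ∀ {j k} → j ≤′ k → n j ≤ n k
    n-mono ≤′-refl         = ≤-refl
    n-mono (≤′-step {k} p) = ≤-trans (n-mono p) (Step.n≤n′ (next k))

    stable : ∀ {j k} → j ≤′ k → ∀ {i} → i < n j → to (g k) i ≡ to (g j) i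
    stable ≤′-refl         i<n = refl
    stable (≤′-step {k} p) i<n = trans (Step.agree (next k) (<-≤-trans i<n (n-mono p))) (stable p i<n)

    stable⁻¹ : ∀ {j k} → j ≤′ k → ∀ {i} → i < j → from (g k) i ≡ from (g j) i
    stable⁻¹ ≤′-refl         i<j = refl
    stable⁻¹ (≤′-step {k} p) i<j = trans (Step.agree⁻¹ (next k) (<-≤-trans i<j (≤′⇒≤ p))) (stable⁻¹ p i<j)

    -- At stage `suc i` both values at `i` are final, since `suc i ≤ n (suc i)`.
    lim lim⁻¹ : Seq
    lim   i = to (g (suc i)) i
    lim⁻¹ i = from (g (suc i)) i

    lim-≡ : ∀ {i k} → i < k → to (g k) i ≡ lim i
    lim-≡ {i} i<k = stable (≤⇒≤′ i<k) (k≤n (suc i))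

    lim⁻¹-≡ : ∀ {i k} → i < k → from (g k) i ≡ lim⁻¹ i
    lim⁻¹-≡ {i} i<k = stable⁻¹ (≤⇒≤′ i<k) ≤-refl

    lim-lim⁻¹ : ∀ i → lim (lim⁻¹ i) ≡ i
    lim-lim⁻¹ i = trans (sym (lim-≡ (m≤n⊔m (suc i) _)))
      (trans (cong (to (g K)) (sym (lim⁻¹-≡ (m≤m⊔n (suc i) (suc (lim⁻¹ i)))))) (to-from (g K) i))
      where K = suc i ⊔ suc (lim⁻¹ i)

    lim⁻¹-lim : ∀ i → lim⁻¹ (lim i) ≡ i
    lim⁻¹-lim i = trans (sym (lim⁻¹-≡ (m≤n⊔m (suc i) _)))
      (trans (cong (from (g K)) (sym (lim-≡ (m≤m⊔n (suc i) (suc (lim i)))))) (from-to (g K) i))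
      where K = suc i ⊔ suc (lim i)

    lim-map : ∀ {m} (v : Vec ℕ m) → ∃ λ K → ∀ {k} → K ≤ k → map (to (g k)) v ≡ map lim v
    lim-map []      = 0 , λ _ → refl
    lim-map (x ∷ v) with K , h ← lim-map v = suc x ⊔ K , λ le →
      cong₂ _∷_ (lim-≡ (≤-trans (m≤m⊔n (suc x) K) le)) (h (≤-trans (m≤n⊔m (suc x) K) le))

    automorphism : A ≅ A
    automorphism = record
      { bij = mk↔ₛ′ lim lim⁻¹ lim-lim⁻¹ lim⁻¹-lim
      ; pres-rel = λ R v → let K , h = lim-map v in
          trans (cong (rel A R) (sym (h ≤-refl))) (_≅_.pres-rel (g K) R v)
      ; pres-fun = λ F v → let K , h = lim-map v ; K′ = K ⊔ suc (fun A F v) in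
          trans (cong (fun A F) (sym (h (m≤m⊔n K _))))
            (trans (_≅_.pres-fun (g K′) F v) (lim-≡ (m≤n⊔m K _))) }

    -- The limit has an index `k` of its own, but step `k` made it differ from the automorphism of
    -- index `k`.
    absurd : ⊥
    absurd = proj₂ (proj₂ (Step.avoid (next k))) automorphism refl
      (trans (sym (lim-≡ (m≤n⊔m (suc k) (suc c))))
             (stable (≤⇒≤′ (m≤m⊔n (suc k) (suc c))) (proj₁ (proj₂ (Step.avoid (next k))))))
      where
      k c : ℕ
      k = index automorphism
      c = proj₁ (Step.avoid (next k))

  abstract
    rigidOver : ∃ λ n → RigidOver n A
    rigidOver = by-contradiction λ ∄n → let ¬rigid = λ n r → ∄n (n , r) in
      Limit.absurd (proj₁ ∘ approx ¬rigid) (proj₂ ∘ approx ¬rigid) (approx-step ¬rigid)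

-- Borel isomorphism relations

bool-injective : ∀ {a b} → bool a ≡ bool b → a ≡ b
bool-injective {false} {false} _ = refl
bool-injective {true}  {true}  _ = refl

Bool-countable : Countable Bool
Bool-countable = bool , bool-injective

module Isomorphisms (em : ClassicalLogic) {L : Language} (countable : CountableLanguage L) where
  open Classical em

  module _ (Z : MeasurableSpace) where
    private module Z = MeasurableSpace Z
    open Measure Z

    rel-value : ∀ {a : Carrier Z → Structure L} → MeasurableCoordinates Z (structures L) a →
                ∀ R v → MeasurableValue Z (λ z → rel (a z) R v)
    rel-value ma R v b = Z.resp (bool-injective , cong bool) (ma (inj₁ (R , v)) (bool b))

    measurable-coordinates : ∀ {a : Carrier Z → Structure L} →
                             (∀ {S} → Basic L S → Measurable Z (a ⊢ S)) →
                             MeasurableCoordinates Z (structures L) a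
    measurable-coordinates     ma (inj₂ (F , v)) m = ma (fun-value F v m)
    measurable-coordinates {a} ma (inj₁ (R , v))   =
      bind-value Z Bool-countable holds (λ b → const-value Z (bool b))
      where
      holds : MeasurableValue Z (λ z → rel (a z) R v)
      holds true  = ma (rel-holds R v)
      holds false = Z.resp (≢true⇒≡false , λ { e e′ → case trans (sym e) e′ of λ () })
                           (Z.compl (ma (rel-holds R v)))
        where
        ≢true⇒≡false : ∀ {b} → b ≢ true → b ≡ false
        ≢true⇒≡false {false} _ = refl
        ≢true⇒≡false {true}  n = contradiction refl n

    preimage-class : ∀ {K} {a : Carrier Z → Structure L} → IsBorelClass L K →
                     MeasurableCoordinates Z (structures L) a → Measurable Z (a ⊢ K)
    preimage-class mK ma = preimage-generated Z
      (λ { (rel-holds R v) → rel-value ma R v true ; (fun-value F v m) → ma (inj₂ (F , v)) m }) mK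

    -- All quantifiers range over countable sets, as the language is countable. A symbol is
    -- evaluated at the varying tuple `map (h z) v` by splitting over the countably many tuples.
    IsIso-measurable : ∀ {a b : Carrier Z → Structure L} {h : Carrier Z → Seq} →
                       MeasurableCoordinates Z (structures L) a →
                       MeasurableCoordinates Z (structures L) b →
                       MeasurableCoordinates Z baire h →
                       Measurable Z (λ z → IsIso (a z) (b z) (h z))
    IsIso-measurable {a} {b} {h} ma mb mh =
      ∩-measurable
        (∀-measurable ℕ-countable λ c → ∀-measurable ℕ-countable λ d →
          →-measurable (≡-measurable Z ℕ-countable (mh c) (mh d)) const-measurable)
      (∩-measurable
        (∀-measurable ℕ-countable λ d → ∃-measurable ℕ-countable λ c → mh c d)
      (∩-measurable
        (∀-measurable (Injection.to (proj₁ countable) , Injection.injective (proj₁ countable)) λ R →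
         ∀-measurable (Vec-countable ℕ-countable _) λ v →
           ≡-measurable Z Bool-countable
             (bind-value Z (Vec-countable ℕ-countable _) (map-value Z mh v) (rel-value mb R))
             (rel-value ma R v))
        (∀-measurable (Injection.to (proj₂ countable) , Injection.injective (proj₂ countable)) λ F →
         ∀-measurable (Vec-countable ℕ-countable _) λ v →
           ≡-measurable Z ℕ-countable
             (bind-value Z (Vec-countable ℕ-countable _) (map-value Z mh v) (λ w → mb (inj₂ (F , w))))
             (bind-value Z ℕ-countable (ma (inj₂ (F , v))) mh))))

  module _ {K : Pred (Structure L) 0ℓ} (mK : IsBorelClass L K)
           (aut : ∀ A → K A → AtMostCountable (Aut A)) where

    private
      C₁ = structures L
      C₂ = C₁ ×ᶜ C₁

    Moved : ℕ → Pred (Structure L) 0ℓ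
    Moved n A = ∃ λ h → K A × IsIso A A h × (∀ i → i < n → h i ≡ i) × ∃ λ c → h c ≢ c

    Moved-analytic : ∀ n → Analytic C₁ (Moved n)
    Moved-analytic n = projection-analytic (Borel⇒analytic
      (∩-measurable (preimage-class Z mK mA)
      (∩-measurable (IsIso-measurable Z mA mA mh)
      (∩-measurable (∀-measurable ℕ-countable λ i → →-measurable const-measurable (mh i i))
        (∃-measurable ℕ-countable λ c → compl (mh c c))))))
      where
      Z = space (C₁ ×ᶜ baire)
      open Measure Z

      mA : MeasurableCoordinates Z C₁ proj₁
      mA i m = gen (cylinder (inj₁ i) m)

      mh : MeasurableCoordinates Z baire proj₂
      mh i m = gen (cylinder (inj₂ i) m)

    Moved-empty : ∀ A → ¬ (∀ n → Moved n A)
    Moved-empty A moved with _ , KA , _ ← moved 0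
      with n , rigid ← Rigidity.rigidOver em A (aut A KA)
      with h , _ , iso , fixes , c , hc≢c ← moved n = hc≢c (rigid (IsIso⇒≅ iso) fixes c)

    abstract
      covers : Separated C₁ Moved
      covers = novikov C₁ Moved-analytic Moved-empty

    -- Members that lie in `K` are rigid over the first `n` numbers, because `Moved n` is contained
    -- in the complement.
    Rigid : ℕ → Pred (Structure L) 0ℓ
    Rigid n = ∁ (proj₁ covers n)

    Rigid-measurable : ∀ n → Measurable (space C₁) (Rigid n)
    Rigid-measurable n = compl (proj₁ (proj₂ covers) n)

    Rigid-exhaust : ∀ A → ∃ λ n → Rigid n A
    Rigid-exhaust A = ¬∀⇒∃¬ (proj₂ (proj₂ (proj₂ covers)) A)

    -- If `g` and `h` differed at `c`, then `h⁻¹ ∘ g` would be an automorphism of `A` fixing the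
    -- numbers below `n` and moving `c`.
    Rigid-unique : ∀ {n A B g h} → K A → Rigid n A → IsIso A B g → IsIso A B h →
                   g ↾ n ≡ h ↾ n → ∀ c → g c ≡ h c
    Rigid-unique {n} {A} {B} {g} {h} KA rigid ig ih g↾n≡h↾n c = by-contradiction λ gc≢hc →
      rigid (proj₁ (proj₂ (proj₂ covers)) n
        ( h⁻¹ ∘ g , KA , ≅⇒IsIso (≅-trans (IsIso⇒≅ ig) (≅-sym (IsIso⇒≅ {A = A} {B} {h} ih)))
        , (λ i i<n → proj₁ ih _ _ (trans (h-h⁻¹ (g i)) (↾-lookup n g↾n≡h↾n i<n)))
        , c , λ h⁻¹gc≡c → gc≢hc (trans (sym (h-h⁻¹ (g c))) (cong h h⁻¹gc≡c))))
      where
      h⁻¹ : Seq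
      h⁻¹ = proj₁ ∘ proj₁ (proj₂ ih)

      h-h⁻¹ : ∀ d → h (h⁻¹ d) ≡ d
      h-h⁻¹ = proj₂ ∘ proj₁ (proj₂ ih)

    Iso : ℕ → List ℕ → Pred ((Structure L × Structure L) × Seq) 0ℓ
    Iso n s ((A , B) , g) = K A × Rigid n A × IsIso A B g × g ↾ n ≡ s

    SendsTo Avoids : ℕ → List ℕ → ℕ → ℕ → Pred (Structure L × Structure L) 0ℓ
    SendsTo n s c d p = ∃ λ g → Iso n s (p , g) × g c ≡ d
    Avoids  n s c d p = ∃ λ g → Iso n s (p , g) × g c ≢ d

    private
      Z₃ = space (C₂ ×ᶜ baire)
      open Measure Z₃

      mh : MeasurableCoordinates Z₃ baire proj₂
      mh i m = gen (cylinder (inj₂ i) m)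

    Iso-measurable : ∀ n s → Measurable Z₃ (Iso n s)
    Iso-measurable n s =
      ∩-measurable (preimage-class Z₃ mK mA)
      (∩-measurable (preimage-space Z₃ mA (Rigid-measurable n))
      (∩-measurable (IsIso-measurable Z₃ mA mB mh)
        (↾-value Z₃ mh n s)))
      where
      mA : MeasurableCoordinates Z₃ C₁ (proj₁ ∘ proj₁)
      mA i m = gen (cylinder (inj₁ (inj₁ i)) m)

      mB : MeasurableCoordinates Z₃ C₁ (proj₂ ∘ proj₁)
      mB i m = gen (cylinder (inj₁ (inj₂ i)) m)

    abstract
      -- Both sets are projections of Borel sets, hence analytic. They are disjoint because two
      -- isomorphisms starting with the same `s` agree at `c` by `Rigid-unique`.
      separation : ∀ n s c d → ∃ λ R → Measurable (space C₂) R × SendsTo n s c d ⊆ R ×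
                                       (∀ p → Avoids n s c d p → ¬ R p)
      separation n s c d = lusin C₂
        (projection-analytic (Borel⇒analytic (∩-measurable (Iso-measurable n s) (mh c d))))
        (projection-analytic (Borel⇒analytic (∩-measurable (Iso-measurable n s) (compl (mh c d)))))
        (λ { p (g , (KA , rigid , ig , gs) , refl) (h , (_ , _ , ih , hs) , hc≢d) →
             hc≢d (Rigid-unique {B = proj₂ p} KA rigid ih ig (trans hs (sym gs)) c) })

    isomorphism-Borel : Measurable (ClassSpace L K ⊗ ClassSpace L K) (IsomorphismRelation K)
    isomorphism-Borel = MeasurableSpace.resp Z (back , forth)
      (∃-measurable′ ℕ-countable λ n → ∃-measurable′ List-countable λ s →
        ∩-measurable′ (preimage-space Z mA (Rigid-measurable n))
                      (IsIso-measurable Z mA mB (mH n s)))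
      where
      Z : MeasurableSpace
      Z = ClassSpace L K ⊗ ClassSpace L K

      open Measure Z using () renaming (∃-measurable to ∃-measurable′; ∩-measurable to ∩-measurable′)

      List-countable : Countable (List ℕ)
      List-countable = code , code-injective

      inclusion : Carrier Z → Structure L × Structure L
      inclusion (A , B) = proj₁ A , proj₁ B

      mA : MeasurableCoordinates Z C₁ (proj₁ ∘ inclusion)
      mA = measurable-coordinates Z λ {S} b → resp (proj₁ , (_, _))
        (gen (rectangle {S = proj₁ ⊢ S} (S , gen b , id , id) (MeasurableSpace.univ (ClassSpace L K))))

      mB : MeasurableCoordinates Z C₁ (proj₂ ∘ inclusion)
      mB = measurable-coordinates Z λ {S} b → resp (proj₂ , (_ ,_))
        (gen (rectangle {T = proj₁ ⊢ S} (MeasurableSpace.univ (ClassSpace L K)) (S , gen b , id , id)))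

      R : ℕ → List ℕ → ℕ → ℕ → Pred (Carrier Z) 0ℓ
      R n s c d = inclusion ⊢ proj₁ (separation n s c d)

      H : ℕ → List ℕ → Carrier Z → Seq
      H n s z c = select Z (R n s c) z

      mH : ∀ n s → MeasurableCoordinates Z baire (H n s)
      mH n s c = select-measurable Z λ d →
        preimage-space Z {C = C₂} {f = inclusion}
          (λ { (inj₁ i) → mA i ; (inj₂ i) → mB i }) (proj₁ (proj₂ (separation n s c d)))

      Defined : Pred (Carrier Z) 0ℓ
      Defined z = ∃ λ n → ∃ λ s → Rigid n (proj₁ (inclusion z)) ×
                                  IsIso (proj₁ (inclusion z)) (proj₂ (inclusion z)) (H n s z)

      back : Defined ⊆ IsomorphismRelation K
      back (n , s , _ , iso) = IsIso⇒≅ iso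

      forth : IsomorphismRelation K ⊆ Defined
      forth {z@((A , KA) , (B , KB))} A≅B with n , rigid ← Rigid-exhaust A =
        n , g ↾ n , rigid , IsIso-resp {B = B} (λ c → sym (select-≡ Z (only c))) ig
        where
        g : Seq
        g = _≅_.to A≅B

        ig : IsIso A B g
        ig = ≅⇒IsIso A≅B

        -- The isomorphism `g` puts the pair in `SendsTo` for `d = g c` and in `Avoids` for every
        -- other `d`. So exactly one separating set contains it, and `select` returns `g c`.
        only : ∀ c → Only Z (R n (g ↾ n) c) (g c) z
        only c = proj₁ (proj₂ (proj₂ (separation n (g ↾ n) c (g c)))) (g , (KA , rigid , ig , refl) , refl)
               , λ d d≢gc → proj₂ (proj₂ (proj₂ (separation n (g ↾ n) c d))) (A , B)
                              (g , (KA , rigid , ig , refl) , ≢-sym d≢gc)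

-- Finite sets of naturals

-- A finite set is listed by its gaps: k ∷ e is {k} ∪ (k + 1 + e).
up : List ℕ → List ℕ
up []      = []
up (k ∷ e) = suc k ∷ e

bit : ℕ → List ℕ → Bool
bit _       []          = false
bit zero    (zero ∷ e)  = true
bit zero    (suc _ ∷ e) = false
bit (suc i) (zero ∷ e)  = bit i e
bit (suc i) (suc k ∷ e) = bit i (k ∷ e)

parity : List ℕ → Bool
parity []      = false
parity (_ ∷ e) = not (parity e)

-- Symmetric difference with the singleton of `i`, where `up` shifts a set by one. Each finite set
-- has exactly one list of gaps, so toggling twice gives back the same list.
toggle : ℕ → List ℕ → List ℕ
toggle zero    []          = zero ∷ []
toggle (suc i) []          = up (toggle i [])
toggle zero    (zero ∷ e)  = up e
toggle zero    (suc k ∷ e) = zero ∷ k ∷ e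
toggle (suc i) (zero ∷ e)  = zero ∷ toggle i e
toggle (suc i) (suc k ∷ e) = up (toggle i (k ∷ e))

bit-zero-up : ∀ e → bit zero (up e) ≡ false
bit-zero-up []      = refl
bit-zero-up (k ∷ e) = refl

bit-suc-up : ∀ i e → bit (suc i) (up e) ≡ bit i e
bit-suc-up i []      = refl
bit-suc-up i (k ∷ e) = refl

parity-up : ∀ e → parity (up e) ≡ parity e
parity-up []      = refl
parity-up (k ∷ e) = refl

toggle-zero-up : ∀ e → toggle zero (up e) ≡ zero ∷ e
toggle-zero-up []      = refl
toggle-zero-up (k ∷ e) = refl

toggle-suc-up : ∀ i e → toggle (suc i) (up e) ≡ up (toggle i e)
toggle-suc-up i []      = refl
toggle-suc-up i (k ∷ e) = refl

toggle-involutive : ∀ i e → toggle i (toggle i e) ≡ e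
toggle-involutive zero    []          = refl
toggle-involutive (suc i) []          =
  trans (toggle-suc-up i (toggle i [])) (cong up (toggle-involutive i []))
toggle-involutive zero    (zero ∷ e)  = toggle-zero-up e
toggle-involutive zero    (suc k ∷ e) = refl
toggle-involutive (suc i) (zero ∷ e)  = cong (zero ∷_) (toggle-involutive i e)
toggle-involutive (suc i) (suc k ∷ e) =
  trans (toggle-suc-up i (toggle i (k ∷ e))) (cong up (toggle-involutive i (k ∷ e)))

parity-toggle : ∀ i e → parity (toggle i e) ≡ not (parity e)
parity-toggle zero    []          = refl
parity-toggle (suc i) []          = trans (parity-up (toggle i [])) (parity-toggle i [])
parity-toggle zero    (zero ∷ e)  = trans (parity-up e) (sym (not-involutive (parity e)))
parity-toggle zero    (suc k ∷ e) = refl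
parity-toggle (suc i) (zero ∷ e)  = cong not (parity-toggle i e)
parity-toggle (suc i) (suc k ∷ e) = trans (parity-up (toggle i (k ∷ e))) (parity-toggle i (k ∷ e))

bit-toggle-≡ : ∀ i e → bit i (toggle i e) ≡ not (bit i e)
bit-toggle-≡ zero    []          = refl
bit-toggle-≡ (suc i) []          = trans (bit-suc-up i (toggle i [])) (bit-toggle-≡ i [])
bit-toggle-≡ zero    (zero ∷ e)  = bit-zero-up e
bit-toggle-≡ zero    (suc k ∷ e) = refl
bit-toggle-≡ (suc i) (zero ∷ e)  = bit-toggle-≡ i e
bit-toggle-≡ (suc i) (suc k ∷ e) = trans (bit-suc-up i (toggle i (k ∷ e))) (bit-toggle-≡ i (k ∷ e))

bit-toggle-≢ : ∀ i j e → j ≢ i → bit j (toggle i e) ≡ bit j e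
bit-toggle-≢ zero    zero    e           j≢i = contradiction refl j≢i
bit-toggle-≢ zero    (suc j) []          j≢i = refl
bit-toggle-≢ zero    (suc j) (zero ∷ e)  j≢i = bit-suc-up j e
bit-toggle-≢ zero    (suc j) (suc k ∷ e) j≢i = refl
bit-toggle-≢ (suc i) zero    []          j≢i = bit-zero-up (toggle i [])
bit-toggle-≢ (suc i) zero    (zero ∷ e)  j≢i = refl
bit-toggle-≢ (suc i) zero    (suc k ∷ e) j≢i = bit-zero-up (toggle i (k ∷ e))
bit-toggle-≢ (suc i) (suc j) []          j≢i =
  trans (bit-suc-up j (toggle i [])) (bit-toggle-≢ i j [] (j≢i ∘ cong suc))
bit-toggle-≢ (suc i) (suc j) (zero ∷ e)  j≢i = bit-toggle-≢ i j e (j≢i ∘ cong suc)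
bit-toggle-≢ (suc i) (suc j) (suc k ∷ e) j≢i =
  trans (bit-suc-up j (toggle i (k ∷ e))) (bit-toggle-≢ i j (k ∷ e) (j≢i ∘ cong suc))

bit-head : ∀ k e → bit k (k ∷ e) ≡ true
bit-head zero    e = refl
bit-head (suc k) e = bit-head k e

odd-inhabited : ∀ e → parity e ≡ true → ∃ λ i → bit i e ≡ true
odd-inhabited (k ∷ e) _ = k , bit-head k e

-- The graph of a tree

data Vertex : Set where
  leaf spine : ℕ → Vertex
  point      : List ℕ → List ℕ → Vertex

Vertex-countable : Countable Vertex
Vertex-countable = injection-countable tagged tagged-injective (×-countable ℕ-countable ℕ-countable)
  where
  tagged : Vertex → ℕ × ℕ
  tagged (leaf n)    = 0 , n
  tagged (spine n)   = 1 , n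
  tagged (point σ e) = 2 , pair (code σ) (code e)

  tagged-injective : ∀ {u v} → tagged u ≡ tagged v → u ≡ v
  tagged-injective {leaf _}    {leaf _}      refl = refl
  tagged-injective {spine _}   {spine _}     refl = refl
  tagged-injective {point σ e} {point σ′ e′} eq
    with p , q ← pair-injective {code σ} (code σ′) (code e′) (cong proj₂ eq) =
    cong₂ point (code-injective p) (code-injective q)

-- Over each node σ of the tree ω^{<ω} there is a point for each finite set e of
-- children, the child i being i ∷ σ. The spine, recognisable by its pendant
-- leaves, tells the nodes apart and carries the marks M.
data Edge (M : List ℕ → List ℕ → Set) : Vertex → Vertex → Set where
  pendant : ∀ {n} → Edge M (leaf n) (spine n)
  ray     : ∀ {n} → Edge M (spine n) (spine (suc n))
  -- Spine vertex 2 code σ identifies the node and the next one carries its mark. An equation for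
  -- `k` keeps the indices of `Edge` simple enough to match on.
  over    : ∀ {σ e k} → k ≡ double (code σ) → Edge M (point σ e) (spine k)
  mark    : ∀ {σ e k} → k ≡ suc (double (code σ)) → M σ e → Edge M (point σ e) (spine k)
  link    : ∀ {σ e i e′} → bit i e ≡ parity e′ → Edge M (point σ e) (point (i ∷ σ) e′)

Adjacent : (List ℕ → List ℕ → Set) → Vertex → Vertex → Set
Adjacent M u v = Edge M u v ⊎ Edge M v u

Adjacent-sym : ∀ {M u v} → Adjacent M u v → Adjacent M v u
Adjacent-sym (inj₁ e) = inj₂ e
Adjacent-sym (inj₂ e) = inj₁ e

∷-≢ : ∀ {i : ℕ} {σ} → i ∷ σ ≢ σ
∷-≢ eq = 1+n≢n (cong length eq)

Edge-irrefl : ∀ {M u v} → Edge M u v → u ≢ v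
Edge-irrefl (ray {n}) eq   = case eq of λ ()
Edge-irrefl (link _)  eq   = ∷-≢ (sym (cong node eq))
  where
  node : Vertex → List ℕ
  node (point σ _) = σ
  node _           = []

with-parity : ∀ b → ∃ λ e → b ≡ parity e
with-parity false = [] , refl
with-parity true  = 0 ∷ [] , refl

-- Separates the vertices from the isolated numbers that code none.
neighbour : ∀ M v → ∃ λ w → Adjacent M v w
neighbour M (leaf n)    = spine n , inj₁ pendant
neighbour M (spine n)   = leaf n , inj₂ pendant
neighbour M (point σ e) = spine (double (code σ)) , inj₁ (over refl)

-- The choice of b interchanges the two parities at the root. The mark at a node
-- outside C forbids interchanging them there.
Mark : Pred (List ℕ) 0ℓ → Bool → List ℕ → List ℕ → Set
Mark C b []      e = parity e ≡ b
Mark C b (i ∷ σ) e = ¬ C (i ∷ σ) × parity e ≡ false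

Path : Pred (List ℕ) 0ℓ → Set
Path C = ∃ λ y → ∀ n → C (y ↾ suc n)

-- What an isomorphism of tree graphs must preserve

module Ray (f f⁻¹ : ℕ → ℕ) (f-f⁻¹ : ∀ n → f (f⁻¹ n) ≡ n) (f⁻¹-f : ∀ n → f⁻¹ (f n) ≡ n) where

  Next : ℕ → ℕ → Set
  Next m n = n ≡ suc m ⊎ m ≡ suc n

  Next-zero : ∀ {n} → Next 0 n → n ≡ 1
  Next-zero (inj₁ e) = e

  module _ (pres : ∀ n → Next (f n) (f (suc n))) (pres⁻¹ : ∀ n → Next (f⁻¹ n) (f⁻¹ (suc n))) where

    Next-sym : ∀ {m n} → Next m n → Next n m
    Next-sym (inj₁ e) = inj₂ e
    Next-sym (inj₂ e) = inj₁ e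

    -- Were `f 0` equal to `suc j`, the two neighbours `j` and `j + 2` would both be pulled back to
    -- neighbours of 0, of which there is only one.
    f-zero : f 0 ≡ 0
    f-zero with f 0 in eq
    ... | zero  = refl
    ... | suc j = contradiction (trans (sym (f-f⁻¹ j)) (trans (cong f same) (f-f⁻¹ (suc (suc j)))))
                                (λ e → m≢1+n+m j {1} e)
      where
      start : f⁻¹ (suc j) ≡ 0
      start = trans (cong f⁻¹ (sym eq)) (f⁻¹-f 0)

      same : f⁻¹ j ≡ f⁻¹ (suc (suc j))
      same = trans (Next-zero (subst (λ m → Next m (f⁻¹ j)) start (Next-sym (pres⁻¹ j))))
                   (sym (Next-zero (subst (λ m → Next m (f⁻¹ (suc (suc j)))) start (pres⁻¹ (suc j)))))

    f-suc : ∀ n → f n ≡ n → f (suc n) ≡ suc n → f (suc (suc n)) ≡ suc (suc n)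
    f-suc n fix fix′ with pres (suc n)
    ... | inj₁ e = trans e (cong suc fix′)
    ... | inj₂ e = contradiction
      (trans (sym (f⁻¹-f (suc (suc n)))) (trans (cong f⁻¹ back) (f⁻¹-f n)))
      (λ e → m≢1+n+m n {1} (sym e))
      where
      back : f (suc (suc n)) ≡ f n
      back = trans (suc-injective (trans (sym e) fix′)) (sym fix)

    f-id : ∀ n → f n ≡ n
    f-id zero          = f-zero
    f-id (suc zero)    = Next-zero (subst (λ m → Next m (f 1)) f-zero (pres 0))
    f-id (suc (suc n)) = f-suc n (f-id n) (f-id (suc n))

record VertexIso (R S : Vertex → Vertex → Set) : Set where
  field
    φ ψ  : Vertex → Vertex
    φ-ψ  : ∀ v → φ (ψ v) ≡ v
    ψ-φ  : ∀ v → ψ (φ v) ≡ v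
    pres : ∀ {u v} → R u v → S (φ u) (φ v)
    pres⁻¹ : ∀ {u v} → S u v → R (ψ u) (ψ v)

inverse : ∀ {R S} → VertexIso R S → VertexIso S R
inverse i = record
  { φ = ψ ; ψ = φ ; φ-ψ = ψ-φ ; ψ-φ = φ-ψ ; pres = pres⁻¹ ; pres⁻¹ = pres }
  where open VertexIso i

module Preservation {M N : List ℕ → List ℕ → Set} (i : VertexIso (Adjacent M) (Adjacent N)) where
  open VertexIso i

  Pendant : (List ℕ → List ℕ → Set) → Vertex → Set
  Pendant M v = ∀ u w → Adjacent M v u → Adjacent M v w → u ≡ w

  leaf-pendant : ∀ {M} n → Pendant M (leaf n)
  leaf-pendant n _ _ (inj₁ pendant) (inj₁ pendant) = refl

  -- A spine vertex is next to its leaf and to the next spine vertex; a point is next to the spine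
  -- and to a point over child 0.
  pendant-leaf : ∀ {M v} → Pendant M v → ∃ λ n → v ≡ leaf n
  pendant-leaf {v = leaf n}    p = n , refl
  pendant-leaf {v = spine n}   p =
    case p (leaf n) (spine (suc n)) (inj₂ pendant) (inj₁ ray) of λ ()
  pendant-leaf {v = point σ e} p =
    let e′ , b = with-parity (bit 0 e) in
    case p (spine _) (point (0 ∷ σ) e′) (inj₁ (over refl)) (inj₁ (link b)) of λ ()

  φ-leaf : ∀ n → ∃ λ k → φ (leaf n) ≡ leaf k
  φ-leaf n = pendant-leaf λ u w vu vw → trans (sym (φ-ψ u)) (trans
    (cong φ (leaf-pendant n _ _ (pull vu) (pull vw))) (φ-ψ w))
    where
    pull : ∀ {u} → Adjacent N (φ (leaf n)) u → Adjacent M (leaf n) (ψ u)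
    pull {u} a = subst (λ v → Adjacent M v (ψ u)) (ψ-φ (leaf n)) (pres⁻¹ a)

  φ-spine : ∀ n → ∃ λ k → φ (spine n) ≡ spine k
  φ-spine n with k , eq ← φ-leaf n = k , next-to-leaf
    (subst (λ v → Adjacent N v (φ (spine n))) eq (pres (inj₁ pendant)))
    where
    next-to-leaf : ∀ {k v} → Adjacent N (leaf k) v → v ≡ spine k
    next-to-leaf (inj₁ pendant) = refl

module Recovery {M N : List ℕ → List ℕ → Set} (i : VertexIso (Adjacent M) (Adjacent N)) where
  open VertexIso i
  open Preservation

  private
    f f⁻¹ : ℕ → ℕ
    f   = proj₁ ∘ φ-spine i
    f⁻¹ = proj₁ ∘ φ-spine (inverse i)

    spine-injective : ∀ {m n} → spine m ≡ spine n → m ≡ n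
    spine-injective refl = refl

    Adjacent-spine : ∀ {M m n} → Adjacent M (spine m) (spine n) → n ≡ suc m ⊎ m ≡ suc n
    Adjacent-spine (inj₁ ray) = inj₁ refl
    Adjacent-spine (inj₂ ray) = inj₂ refl

    cancel : ∀ {R S} (i : VertexIso R S) {f f⁻¹ : ℕ → ℕ} →
             (∀ n → VertexIso.φ i (spine n) ≡ spine (f n)) →
             (∀ n → VertexIso.ψ i (spine n) ≡ spine (f⁻¹ n)) → ∀ n → f (f⁻¹ n) ≡ n
    cancel i {f} {f⁻¹} eq eq⁻¹ n = spine-injective
      (trans (sym (eq (f⁻¹ n))) (trans (cong (VertexIso.φ i) (sym (eq⁻¹ n))) (VertexIso.φ-ψ i (spine n))))

    step : ∀ {M N} (i : VertexIso (Adjacent M) (Adjacent N)) n →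
           let f = proj₁ ∘ φ-spine i in f (suc n) ≡ suc (f n) ⊎ f n ≡ suc (f (suc n))
    step {N = N} i n = Adjacent-spine
      (subst₂ (Adjacent N) (proj₂ (φ-spine i n)) (proj₂ (φ-spine i (suc n))) (VertexIso.pres i (inj₁ ray)))

  φ-spine-≡ : ∀ n → φ (spine n) ≡ spine n
  φ-spine-≡ n = trans (proj₂ (φ-spine i n)) (cong spine
    (Ray.f-id f f⁻¹
      (cancel i (proj₂ ∘ φ-spine i) (proj₂ ∘ φ-spine (inverse i)))
      (cancel (inverse i) (proj₂ ∘ φ-spine (inverse i)) (proj₂ ∘ φ-spine i))
      (step i) (step (inverse i)) n))

  -- A leaf or spine image would pull back to a leaf or spine vertex. The node is preserved because
  -- the spine is fixed pointwise and the even spine neighbour of a point codes its node.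
  φ-point : ∀ σ e → ∃ λ e′ → φ (point σ e) ≡ point σ e′
  φ-point σ e with φ (point σ e) in eq
  ... | leaf k    = case trans (trans (sym (ψ-φ (point σ e))) (cong ψ eq))
                      (proj₂ (φ-leaf (inverse i) k)) of λ ()
  ... | spine k   = case trans (trans (sym (ψ-φ (point σ e))) (cong ψ eq))
                      (proj₂ (φ-spine (inverse i) k)) of λ ()
  ... | point τ d = d , cong (λ σ → point σ d) (same-node
                      (subst₂ (Adjacent N) eq (φ-spine-≡ (double (code σ))) (pres (inj₁ (over refl)))))
    where
    same-node : Adjacent N (point τ d) (spine (double (code σ))) → τ ≡ σ
    same-node (inj₁ (over e))   = sym (code-injective (double-injective e))
    same-node (inj₁ (mark e _)) = contradiction e double≢suc-double

  action : List ℕ → List ℕ → List ℕ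
  action σ e = proj₁ (φ-point σ e)

  action-mark : ∀ {σ e} → M σ e → N σ (action σ e)
  action-mark {σ} {e} m = marked (subst₂ (Adjacent N)
    (proj₂ (φ-point σ e)) (φ-spine-≡ (suc (double (code σ)))) (pres (inj₁ (mark refl m))))
    where
    marked : ∀ {d} → Adjacent N (point σ d) (spine (suc (double (code σ)))) → N σ d
    marked (inj₁ (over e))   = contradiction (sym e) double≢suc-double
    marked (inj₁ (mark _ m)) = m

  action-link : ∀ {σ e j e′} → bit j e ≡ parity e′ → bit j (action σ e) ≡ parity (action (j ∷ σ) e′)
  action-link {σ} {e} {j} {e′} b = linked (subst₂ (Adjacent N)
    (proj₂ (φ-point σ e)) (proj₂ (φ-point (j ∷ σ) e′)) (pres (inj₁ (link b))))
    where
    linked : ∀ {d d′} → Adjacent N (point σ d) (point (j ∷ σ) d′) → bit j d ≡ parity d′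
    linked (inj₁ (link b)) = b

-- Isomorphisms and infinite paths

module Graphs (em : ClassicalLogic) where
  open Classical em

  module _ {C : Pred (List ℕ) 0ℓ} where

    isomorphism⇒path : VertexIso (Adjacent (Mark C false)) (Adjacent (Mark C true)) → Path C
    isomorphism⇒path i = y , λ n → Flipped⇒C (subst Flipped (sym (y-↾ (suc n))) (proj₂ (node (suc n))))
      where
      open VertexIso i
      open Recovery i using (action; action-mark; action-link; φ-point)
      module I⁻¹ = Recovery (inverse i)

      action⁻¹-action : ∀ σ e → I⁻¹.action σ (action σ e) ≡ e
      action⁻¹-action σ e = set-≡ (trans (sym (proj₂ (I⁻¹.φ-point σ (action σ e))))
                                    (trans (cong ψ (sym (proj₂ (φ-point σ e)))) (ψ-φ (point σ e))))
        where
        set-≡ : ∀ {σ d e} → point σ d ≡ point σ e → d ≡ e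
        set-≡ refl = refl

      Flipped : Pred (List ℕ) 0ℓ
      Flipped σ = ∀ e → parity (action σ e) ≡ not (parity e)

      -- The root marks are the even sets on one side and the odd sets on the other, so both the
      -- isomorphism and its inverse exchange them.
      Flipped-root : Flipped []
      Flipped-root e with parity e in even
      ... | false = action-mark even
      ... | true with parity (action [] e) in odd
      ...   | false = refl
      ...   | true  = case trans (sym even) (subst (λ e → parity e ≡ false) (action⁻¹-action [] e)
                             (I⁻¹.action-mark {[]} odd)) of λ ()

      -- The image of the empty set is odd, hence has an element `j`. The empty set is linked to the
      -- even sets over child `j` and its image to the odd ones, so parity is exchanged there too.
      Flipped-child : ∀ σ → Flipped σ → ∃ λ i → Flipped (i ∷ σ)
      Flipped-child σ flipped with j , b ← odd-inhabited (action σ []) (flipped []) = j , child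
        where
        child : Flipped (j ∷ σ)
        child e with parity e in odd
        ... | false = trans (sym (action-link {σ} {[]} {j} {e} (sym odd))) b
        ... | true with parity (action (j ∷ σ) e) in odd′
        ...   | false = refl
        ...   | true  = case subst (λ d → bit j d ≡ true) (action⁻¹-action σ [])
                          (trans (I⁻¹.action-link (trans b (sym odd′)))
                            (trans (cong parity (action⁻¹-action (j ∷ σ) e)) odd)) of λ ()

      -- Outside `C` the even sets are marked on both sides, so the even empty set has an even
      -- image.
      Flipped⇒C : ∀ {i σ} → Flipped (i ∷ σ) → C (i ∷ σ)
      Flipped⇒C {i} {σ} flipped = by-contradiction λ ¬c →
        case trans (sym (flipped [])) (proj₂ (action-mark {i ∷ σ} {[]} (¬c , refl))) of λ ()

      node : ∀ n → Σ (List ℕ) Flipped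
      child : ∀ n → ∃ λ i → Flipped (i ∷ proj₁ (node n))

      node zero    = [] , Flipped-root
      node (suc n) = proj₁ (child n) ∷ proj₁ (node n) , proj₂ (child n)

      child n = Flipped-child (proj₁ (node n)) (proj₂ (node n))

      y : Seq
      y = proj₁ ∘ child

      y-↾ : ∀ n → y ↾ n ≡ proj₁ (node n)
      y-↾ zero    = refl
      y-↾ (suc n) = cong (y n ∷_) (y-↾ n)

    -- At each node of the path, toggle the child through which the path continues. This changes
    -- parity exactly on the path, and changes bit `i` over σ exactly when `i ∷ σ` is on the path,
    -- so links survive. Nodes outside `C` are off the path, so their marks stay.
    path⇒isomorphism : Path C → VertexIso (Adjacent (Mark C false)) (Adjacent (Mark C true))
    path⇒isomorphism (y , path) = record
      { φ = act ; ψ = act ; φ-ψ = act-involutive ; ψ-φ = act-involutive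
      ; pres   = λ { (inj₁ e) → inj₁ (act-edge false e) ; (inj₂ e) → inj₂ (act-edge false e) }
      ; pres⁻¹ = λ { (inj₁ e) → inj₁ (act-edge true e) ; (inj₂ e) → inj₂ (act-edge true e) } }
      where
      On : Pred (List ℕ) 0ℓ
      On σ = σ ≡ y ↾ length σ

      twistᵈ : ∀ {σ} → Dec (On σ) → List ℕ → List ℕ
      twistᵈ {σ} (yes _) e = toggle (y (length σ)) e
      twistᵈ     (no _)  e = e

      twist : List ℕ → List ℕ → List ℕ
      twist σ = twistᵈ {σ} lem

      twist-involutive : ∀ σ e → twist σ (twist σ e) ≡ e
      twist-involutive σ e = lemma lem
        where
        lemma : (d : Dec (On σ)) → twistᵈ d (twistᵈ d e) ≡ e
        lemma (yes _) = toggle-involutive (y (length σ)) e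
        lemma (no _)  = refl

      twist-on : ∀ {σ} → On σ → ∀ e → twist σ e ≡ toggle (y (length σ)) e
      twist-on {σ} on e = lemma lem
        where
        lemma : (d : Dec (On σ)) → twistᵈ d e ≡ toggle (y (length σ)) e
        lemma (yes _)  = refl
        lemma (no off) = contradiction on off

      twist-off : ∀ {σ} → ¬ On σ → ∀ e → twist σ e ≡ e
      twist-off {σ} off e = lemma lem
        where
        lemma : (d : Dec (On σ)) → twistᵈ d e ≡ e
        lemma (yes on) = contradiction on off
        lemma (no _)   = refl

      act : Vertex → Vertex
      act (point σ e) = point σ (twist σ e)
      act v           = v

      act-involutive : ∀ v → act (act v) ≡ v
      act-involutive (leaf _)    = refl
      act-involutive (spine _)   = refl
      act-involutive (point σ e) = cong (point σ) (twist-involutive σ e)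

      act-mark : ∀ b {σ e} → Mark C b σ e → Mark C (not b) σ (twist σ e)
      act-mark b {[]} {e} refl =
        trans (cong parity (twist-on {[]} refl e)) (parity-toggle (y 0) e)
      act-mark b {i ∷ σ} {e} (¬c , even) =
        ¬c , trans (cong parity (twist-off (λ on → ¬c (subst C (sym on) (path (length σ)))) e)) even

      act-link : ∀ {σ e i e′} → bit i e ≡ parity e′ → bit i (twist σ e) ≡ parity (twist (i ∷ σ) e′)
      act-link {σ} {e} {i} {e′} b = lemma lem
        where
        unchanged : ¬ On (i ∷ σ) → (d : Dec (On σ)) → bit i (twistᵈ d e) ≡ bit i e
        -- The path leaves σ through another child, so the toggled bit is not bit `i`.
        unchanged off (yes on) = bit-toggle-≢ (y (length σ)) i e (λ i≡ → off (cong₂ _∷_ i≡ on))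
        unchanged off (no _)   = refl

        lemma : (d : Dec (On (i ∷ σ))) → bit i (twist σ e) ≡ parity (twistᵈ d e′)
        lemma (no off) = trans (unchanged off lem) b
        lemma (yes on) = trans (cong (bit i) (twist-on (∷-injectiveʳ on) e))
          (trans (subst (λ j → bit i (toggle j e) ≡ not (bit i e)) (∷-injectiveˡ on) (bit-toggle-≡ i e))
          (trans (cong not b) (sym (parity-toggle (y (length (i ∷ σ))) e′))))

      act-edge : ∀ b {u v} → Edge (Mark C b) u v → Edge (Mark C (not b)) (act u) (act v)
      act-edge b pendant             = pendant
      act-edge b ray                 = ray
      act-edge b (over e)            = over e
      act-edge b (mark {σ} {e} eq m) = mark eq (act-mark b {σ} {e} m)
      act-edge b (link eq)           = link (act-link eq)

-- Coding the graphs on ω and the failure of Borel completeness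

module Encoding (em : ClassicalLogic) where
  open Classical em

  enc : Vertex → ℕ
  enc = proj₁ Vertex-countable

  enc-injective : ∀ {u v} → enc u ≡ enc v → u ≡ v
  enc-injective = proj₂ Vertex-countable

  -- Numbers that code no vertex are isolated.
  Joined : (Vertex → Vertex → Set) → ℕ → ℕ → Set
  Joined R m n = ∃ λ u → ∃ λ v → enc u ≡ m × enc v ≡ n × R u v

  graph : (Vertex → Vertex → Set) → Structure graphLanguage
  graph R = record { rel = λ { _ (m ∷ n ∷ []) → does (lem {P = Joined R m n}) } ; fun = λ () }

  does⇒ : ∀ {P : Set} (d : Dec P) → does d ≡ true → P
  does⇒ (yes p) _ = p

  adj⇒Joined : ∀ {R m n} → adj (graph R) m n ≡ true → Joined R m n
  adj⇒Joined = does⇒ lem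

  Joined⇒adj : ∀ {R m n} → Joined R m n → adj (graph R) m n ≡ true
  Joined⇒adj = dec-true lem

  Joined-enc : ∀ {R u v} → Joined R (enc u) (enc v) → R u v
  Joined-enc {R} (u′ , v′ , p , q , r) = subst₂ R (enc-injective p) (enc-injective q) r

  graph-IsGraph : ∀ {R} → (∀ {u v} → R u v → R v u) → (∀ {u} → ¬ R u u) → IsGraph (graph R)
  graph-IsGraph {R} R-sym R-irrefl =
      (λ x → dec-false lem λ (u , v , p , q , r) →
        R-irrefl (subst (R u) (enc-injective (trans q (sym p))) r))
    , (λ x y → does-⇔ (mk⇔ flip flip) lem lem)
    where
    flip : ∀ {m n} → Joined R m n → Joined R n m
    flip (u , v , p , q , r) = v , u , q , p , R-sym r

  module _ {R S : Vertex → Vertex → Set} where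

    private
      -- The default is the argument itself, so numbers coding no vertex are fixed.
      lift : (Vertex → Vertex) → ℕ → ℕ
      lift φ n = extend enc (enc ∘ φ) n n

      lift-enc : ∀ φ v → lift φ (enc v) ≡ enc (φ v)
      lift-enc φ v = extend-∘ Vertex-countable (enc ∘ φ) v

      lift-∘ : ∀ φ ψ → (∀ v → φ (ψ v) ≡ v) → ∀ n → lift φ (lift ψ n) ≡ n
      lift-∘ φ ψ φ-ψ n = by-cases lem
        where
        by-cases : Dec (∃ λ v → enc v ≡ n) → lift φ (lift ψ n) ≡ n
        by-cases (yes (v , refl)) =
          trans (cong (lift φ) (lift-enc ψ v)) (trans (lift-enc φ (ψ v)) (cong enc (φ-ψ v)))
        by-cases (no ∄v) = trans (cong (lift φ) (extend-∉ ∄v)) (extend-∉ ∄v)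

    VertexIso⇒≅ : VertexIso R S → graph R ≅ graph S
    VertexIso⇒≅ i = record
      { bij = mk↔ₛ′ (lift φ) (lift ψ) (lift-∘ φ ψ φ-ψ) (lift-∘ ψ φ ψ-φ)
      ; pres-rel = λ { _ (m ∷ n ∷ []) → does-⇔ (mk⇔ back forth) lem lem }
      ; pres-fun = λ () }
      where
      open VertexIso i

      forth : ∀ {m n} → Joined R m n → Joined S (lift φ m) (lift φ n)
      forth (u , v , refl , refl , r) = φ u , φ v , sym (lift-enc φ u) , sym (lift-enc φ v) , pres r

      back : ∀ {m n} → Joined S (lift φ m) (lift φ n) → Joined R m n
      back {m} {n} (u , v , p , q , s) = ψ u , ψ v , pull p , pull q , pres⁻¹ s
        where
        pull : ∀ {m u} → enc u ≡ lift φ m → enc (ψ u) ≡ m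
        pull {m} {u} e = trans (sym (lift-enc ψ u)) (trans (cong (lift ψ) e) (lift-∘ ψ φ ψ-φ m))

  module _ {R S : Vertex → Vertex → Set} (connected : ∀ v → ∃ (R v)) (g : graph R ≅ graph S) where
    open _≅_ g

    forward : ∀ {u v} → R u v → Joined S (to (enc u)) (to (enc v))
    forward {u} {v} r = adj⇒Joined {S}
      (trans (pres-rel tt (enc u ∷ enc v ∷ [])) (Joined⇒adj {R} (u , v , refl , refl , r)))

    -- The code of `v` has a neighbour, hence so does its image, and only codes of vertices have
    -- neighbours.
    image : ∀ v → ∃ λ v′ → enc v′ ≡ to (enc v)
    image v = let v′ , _ , e , _ = forward (proj₂ (connected v)) in v′ , e

    image-preserves : ∀ {u v} → R u v → S (proj₁ (image u)) (proj₁ (image v))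
    image-preserves {u} {v} r = Joined-enc
      (subst₂ (Joined S) (sym (proj₂ (image u))) (sym (proj₂ (image v))) (forward r))

  ≅⇒VertexIso : ∀ {R S} → (∀ v → ∃ (R v)) → (∀ v → ∃ (S v)) → graph R ≅ graph S → VertexIso R S
  ≅⇒VertexIso {R} {S} cR cS g = record
    { φ = proj₁ ∘ image cR g ; ψ = proj₁ ∘ image cS (≅-sym g)
    ; φ-ψ = λ v → enc-injective (trans (proj₂ (image cR g _))
        (trans (cong to (proj₂ (image cS (≅-sym g) v))) (strictlyInverseˡ (enc v))))
    ; ψ-φ = λ v → enc-injective (trans (proj₂ (image cS (≅-sym g) _))
        (trans (cong from (proj₂ (image cR g v))) (strictlyInverseʳ (enc v))))
    ; pres = image-preserves cR g ; pres⁻¹ = image-preserves cS (≅-sym g) }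
    where
    open _≅_ g
    open Inverse bij using (strictlyInverseˡ; strictlyInverseʳ)

  -- A point of Baire space as the code of a closed set

  Literal-countable : Countable (Literal ℕ)
  Literal-countable = injection-countable tagged tagged-injective
    (×-countable ℕ-countable (×-countable ℕ-countable ℕ-countable))
    where
    tagged : Literal ℕ → ℕ × ℕ × ℕ
    tagged never    = 0 , 0 , 0
    tagged (i is m) = 1 , i , m

    tagged-injective : ∀ {k l} → tagged k ≡ tagged l → k ≡ l
    tagged-injective {never}  {never}  refl = refl
    tagged-injective {_ is _} {_ is _} refl = refl

  Node-countable : Countable (List ℕ × Literal ℕ)
  Node-countable = ×-countable (code , code-injective) Literal-countable

  -- Here `x` plays two roles: it lists the literals demanded at each node, and it is the point on
  -- which they are tested. This is the diagonal used below.
  Tree : Seq → Pred (List ℕ) 0ℓ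
  Tree x σ = ∀ l → x (proj₁ Node-countable (σ , l)) ≡ 1 → Holds baire l x

  Illfounded : Pred Seq 0ℓ
  Illfounded x = Path (Tree x)

  -- Let `x₀` code the given analytic representation by listing, at each σ, the literals demanded by
  -- all extensions of σ. Then `x₀` is ill-founded iff the representation accepts `x₀`, that is, iff
  -- `x₀` is not ill-founded.
  Illfounded-not-coanalytic : ¬ Analytic baire (∁ Illfounded)
  Illfounded-not-coanalytic a = ¬illfounded (⇐ (proj₁ (member a) ¬illfounded))
    where
    D : Seq → Pred (Literal ℕ) 0ℓ
    D = Demands a

    Forced : List ℕ × Literal ℕ → Set
    Forced (σ , l) = ∀ y → y ↾ length σ ≡ σ → D y l

    truth : ∀ {P : Set} → Dec P → ℕ
    truth d = bool (does d)

    truth⇒ : ∀ {P : Set} (d : Dec P) → truth d ≡ 1 → P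
    truth⇒ (yes p) _ = p

    ⇒truth : ∀ {P : Set} (d : Dec P) → P → truth d ≡ 1
    ⇒truth d p = cong bool (dec-true d p)

    x₀ : Seq
    x₀ = extend (proj₁ Node-countable) (λ s → truth (lem {P = Forced s})) 0

    x₀-code : ∀ s → x₀ (proj₁ Node-countable s) ≡ truth (lem {P = Forced s})
    x₀-code = extend-∘ Node-countable (λ s → truth (lem {P = Forced s}))

    Member : Set
    Member = ∃ λ y → ∀ l → D y l → Holds baire l x₀

    ⇒ : Illfounded x₀ → Member
    ⇒ (y , path) = y , λ l d → let n , h = Demands-open a l {y} d in
      -- Nodes of a path have length at least 1, so a demand forced by `y ↾ n` is read off at
      -- `y ↾ suc n`.
      path n l (trans (x₀-code (y ↾ suc n , l)) (⇒truth lem λ z z↾ →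
        h (↾-mono (n≤1+n n) (subst (λ k → z ↾ k ≡ y ↾ suc n) (length-↾ y (suc n)) z↾))))

    ⇐ : Member → Illfounded x₀
    ⇐ (y , h) = y , λ n l e → h l (truth⇒ lem (trans (sym (x₀-code (y ↾ suc n , l))) e) y
      (cong (y ↾_) (length-↾ y (suc n))))

    ¬illfounded : ¬ Illfounded x₀
    ¬illfounded i = proj₂ (member a) (⇒ i) i

  Illfounded-not-Borel : ¬ Measurable (space baire) Illfounded
  Illfounded-not-Borel m = Illfounded-not-coanalytic (Borel⇒analytic (compl m))

  treeGraph : Bool → Seq → Carrier GraphSpace
  treeGraph b x = graph (Adjacent (Mark (Tree x) b))
                , graph-IsGraph Adjacent-sym
                    (λ { (inj₁ e) → Edge-irrefl e refl ; (inj₂ e) → Edge-irrefl e refl })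

  Illfounded⇔≅ : ∀ x → Illfounded x ⇔ (proj₁ (treeGraph false x) ≅ proj₁ (treeGraph true x))
  Illfounded⇔≅ x = mk⇔ (VertexIso⇒≅ ∘ path⇒isomorphism)
    (isomorphism⇒path ∘ ≅⇒VertexIso (neighbour (Mark (Tree x) false)) (neighbour (Mark (Tree x) true)))
    where open Graphs em

  open Measure (space baire)

  Tree-measurable : ∀ σ → Measurable (space baire) (λ x → Tree x σ)
  Tree-measurable σ = ∀-measurable Literal-countable λ l →
    →-measurable (gen (cylinder _ 1)) (Holds-measurable l)
    where
    Holds-measurable : ∀ l → Measurable (space baire) (Holds baire l)
    Holds-measurable never    = ∅-measurable
    Holds-measurable (i is m) = gen (cylinder i m)

  -- Only the marks depend on `x`; the remaining edges are those of the graph with no marks.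
  Edge-measurable : ∀ b u v → Measurable (space baire) (λ x → Edge (Mark (Tree x) b) u v)
  Edge-measurable b u v = resp
    ( (λ { (inj₁ e) → unmarked e ; (inj₂ (_ , _ , refl , refl , m)) → mark refl m })
    , split)
    (∪-measurable const-measurable
      (∃-measurable (code , code-injective) λ σ → ∃-measurable (code , code-injective) λ e →
        ∩-measurable const-measurable (∩-measurable const-measurable (Mark-measurable σ e))))
    where
    unmarked : ∀ {M u v} → Edge (λ _ _ → ⊥) u v → Edge M u v
    unmarked pendant  = pendant
    unmarked ray      = ray
    unmarked (over e) = over e
    unmarked (link e) = link e

    split : ∀ {M u v} → Edge M u v → Edge (λ _ _ → ⊥) u v ⊎
            ∃₂ λ σ e → u ≡ point σ e × v ≡ spine (suc (double (code σ))) × M σ e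
    split pendant       = inj₁ pendant
    split ray           = inj₁ ray
    split (over e)      = inj₁ (over e)
    split (mark refl m) = inj₂ (_ , _ , refl , refl , m)
    split (link e)      = inj₁ (link e)

    Mark-measurable : ∀ σ e → Measurable (space baire) (λ x → Mark (Tree x) b σ e)
    Mark-measurable []      e = const-measurable
    Mark-measurable (i ∷ σ) e = ∩-measurable (compl (Tree-measurable (i ∷ σ))) const-measurable

  treeGraph-measurable : ∀ b → MeasurableMap (space baire) GraphSpace (treeGraph b)
  treeGraph-measurable b (T , mT , S⊆T , T⊆S) = resp (T⊆S , S⊆T)
    (preimage-generated (space baire) {f = proj₁ ∘ treeGraph b}
      (λ { (rel-holds tt (m ∷ n ∷ [])) → resp (Joined⇒adj , adj⇒Joined)
             (∃-measurable Vertex-countable λ u → ∃-measurable Vertex-countable λ v →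
               ∩-measurable const-measurable (∩-measurable const-measurable
                 (∪-measurable (Edge-measurable b u v) (Edge-measurable b v u)))) }) mT)

  -- A Borel reduction applied to the two tree graphs of `x` gives a measurable map into pairs,
  -- under which the isomorphism relation pulls back to `Illfounded`.
  Borel-isomorphism⇒¬BorelComplete :
    ∀ {L K} → Measurable (ClassSpace L K ⊗ ClassSpace L K) (IsomorphismRelation K) → ¬ BorelComplete L K
  Borel-isomorphism⇒¬BorelComplete {L} {K} mE (f , mf , reduces) = Illfounded-not-Borel (resp
    ( (λ {x} → Equivalence.from (Illfounded⇔≅ x) ∘
               Equivalence.from (reduces (treeGraph false x) (treeGraph true x)))
    , (λ {x} → Equivalence.to (reduces (treeGraph false x) (treeGraph true x)) ∘
               Equivalence.to (Illfounded⇔≅ x)))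
    (preimage-generated (space baire) {f = λ x → f (treeGraph false x) , f (treeGraph true x)}
      (λ { (rectangle mS mT) → ∩-measurable (treeGraph-measurable false (mf mS))
                                            (treeGraph-measurable true (mf mT)) })
      mE))

proposition1p2 : ClassicalLogic →
    (L : Language) → CountableLanguage L →
    (K : Pred (Structure L) 0ℓ) → IsBorelClass L K →
    (∀ A → K A → AtMostCountable (Aut A)) →
    Measurable (ClassSpace L K ⊗ ClassSpace L K) (IsomorphismRelation K) ×
    ¬ BorelComplete L K
proposition1p2 em L countable K mK aut = borel , Encoding.Borel-isomorphism⇒¬BorelComplete em borel
  where
  borel : Measurable (ClassSpace L K ⊗ ClassSpace L K) (IsomorphismRelation K)
  borel = Isomorphisms.isomorphism-Borel em countable mK aut
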